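{- Fix integers $r\ge 4$ and $k\ge 2$, and real numbers $P>0$ and $C>0$. There exists $M=M(r,k,P,C)$ such that every graph $G$ with $$\chi(G)\ge M,\qquad e(G)\le C\,\chi(G)^P$$ contains a subgraph $H$ with $\operatorname{girth}(H)\ge r$ and $\chi(H)\ge k$.
   Context: All graphs are finite and simple; subgraphs need not be induced. $\chi$ is the chromatic number, $e(G)$ the number of edges. The girth of a forest is $\infty$. -}

module Defs where

import Algebra.Definitions.RawSemiring as RawSemiringDefs
open import Data.Fin.Base using (Fin; toℕ; funToFin; finToFun)
open import Data.Fin.Properties
  using (any?; all?; injective⇒≤; finToFun-funToFin) renaming (_≟_ to _≟ᶠ_)
import Data.Fin.Properties as Finₚ
open import Data.Integer.Base using (+_; ∣_∣)
import Data.Integer.Base as ℤ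
import Data.Integer.Properties as ℤₚ
open import Data.List.Base using (allFin; cartesianProduct; filter; length)
open import Data.Nat.Base using (ℕ; zero; suc; _≤_; z≤n; s≤s)
import Data.Nat.Base as ℕ
import Data.Nat.Properties as ℕₚ
open import Data.Product.Base using (Σ; ∃; ∃-syntax; _×_; _,_; proj₁; proj₂)
open import Data.Rational.Base using (ℚ; mkℚ; 0ℚ; 1ℚ; _/_; *<*)
import Data.Rational.Base as ℚ
import Data.Rational.Properties as ℚₚ
open import Data.Sum.Base using (_⊎_; inj₁; inj₂)
open import Function.Base using (_∘_; id)
open import Function.Definitions using (Injective)
open import Level using (0ℓ)
open import Relation.Binary.Core using (Rel)
import Relation.Binary.Construct.Add.Supremum.NonStrict as AddSup
import Relation.Binary.Definitions as B
open import Relation.Binary.PropositionalEquality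
  using (_≡_; _≢_; _≗_; sym; trans; subst; subst₂)
open import Relation.Nullary using (Dec; yes; no; ¬_; ¬?; contradiction)
open import Relation.Nullary.Construct.Add.Supremum public using (_⁺; ⊤⁺; [_])
open import Relation.Nullary.Decidable using (map′; _×-dec_; _⊎-dec_; _→-dec_)
open import Relation.Unary using (Pred; Decidable)

------------------------------------------------------------------------
-- Real numbers

-- A real x is given by its upper Dedekind cut, the set {q ∈ ℚ | x < q}:
-- a set of rationals that is nonempty, bounded below, upward closed and
-- without least element.  Classically these are exactly the reals;
-- locatedness is not required.

record ℝ : Set₁ where
  field
    Above     : Pred ℚ 0ℓ
    inhabited : ∃[ q ] Above q
    bounded   : ∃[ l ] (∀ {q} → Above q → l ℚ.≤ q)
    upward    : ∀ {p q} → p ℚ.< q → Above p → Above q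
    open′     : ∀ {q} → Above q → ∃[ p ] (p ℚ.< q × Above p)

open ℝ public

infix 4 _≤ℝ_

_≤ℝ_ : Rel ℝ 0ℓ
x ≤ℝ y = ∀ {q} → Above y q → Above x q

-- Some positive rational ε satisfies ε ≤ x.
Positiveℝ : Pred ℝ 0ℓ
Positiveℝ x = ∃[ ε ] (0ℚ ℚ.< ε × (∀ {q} → Above x q → ε ℚ.≤ q))

ℕ→ℚ : ℕ → ℚ
ℕ→ℚ n = + n / 1

q<q+1 : ∀ q → q ℚ.< q ℚ.+ 1ℚ
q<q+1 q = subst (ℚ._< q ℚ.+ 1ℚ) (ℚₚ.+-identityʳ q)
            (ℚₚ.+-monoʳ-< q {0ℚ} {1ℚ} (ℚₚ.positive⁻¹ 1ℚ))

ℚ→ℝ : ℚ → ℝ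
ℚ→ℝ x = record
  { Above     = x ℚ.<_
  ; inhabited = x ℚ.+ 1ℚ , q<q+1 x
  ; bounded   = x , ℚₚ.<⇒≤
  ; upward    = λ p<q x<p → ℚₚ.<-trans x<p p<q
  ; open′     = λ x<q → let m , x<m , m<q = ℚₚ.<-dense x<q in m , m<q , x<m
  }

ℕ→ℝ : ℕ → ℝ
ℕ→ℝ n = ℚ→ℝ (ℕ→ℚ n)

infixl 7 _*ℝ_

positiveAbove : ∀ x → ∃[ q ] (0ℚ ℚ.< q × Above x q)
positiveAbove x with inhabited x
... | q , x<q with 0ℚ ℚₚ.<? q
...   | yes 0<q = q , 0<q , x<q
...   | no  0≮q = 1ℚ , ℚₚ.positive⁻¹ 1ℚ ,
                  upward x (ℚₚ.≤-<-trans (ℚₚ.≮⇒≥ 0≮q) (ℚₚ.positive⁻¹ 1ℚ)) x<q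

-- The product of two nonnegative reals; a negative argument is treated
-- as 0.
_*ℝ_ : ℝ → ℝ → ℝ
x *ℝ y = record
  { Above     = λ q → ∃[ a ] ∃[ b ]
                  (0ℚ ℚ.< a × Above x a × 0ℚ ℚ.< b × Above y b × a ℚ.* b ℚ.< q)
  ; inhabited = let a , 0<a , x<a = positiveAbove x
                    b , 0<b , y<b = positiveAbove y
                in a ℚ.* b ℚ.+ 1ℚ , a , b , 0<a , x<a , 0<b , y<b , q<q+1 (a ℚ.* b)
  ; bounded   = 0ℚ , λ (a , b , 0<a , _ , 0<b , _ , ab<q) →
                  ℚₚ.<⇒≤ (ℚₚ.<-trans (0<ab a b 0<a 0<b) ab<q)
  ; upward    = λ p<q (a , b , 0<a , x<a , 0<b , y<b , ab<p) →
                  a , b , 0<a , x<a , 0<b , y<b , ℚₚ.<-trans ab<p p<q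
  ; open′     = λ (a , b , 0<a , x<a , 0<b , y<b , ab<q) →
                  let m , ab<m , m<q = ℚₚ.<-dense ab<q
                  in m , m<q , a , b , 0<a , x<a , 0<b , y<b , ab<m
  }
  where
  0<ab : ∀ a b → 0ℚ ℚ.< a → 0ℚ ℚ.< b → 0ℚ ℚ.< a ℚ.* b
  0<ab a b 0<a 0<b = ℚₚ.positive⁻¹ (a ℚ.* b)
    {{ℚₚ.pos*pos⇒pos a {{ℚ.positive 0<a}} b {{ℚ.positive 0<b}}}}

infixr 8 _^ℚ_ _^ℝ_

_^ℚ_ : ℚ → ℕ → ℚ
_^ℚ_ = RawSemiringDefs._^_ ℚ.+-*-rawSemiring

natAbove : ∀ x → ∃[ a ] Above x (+ a / 1)
natAbove x with inhabited x
... | q , x<q = suc ∣ ℚ.↥ q ∣ , upward x (q<n q) x<q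
  where
  open import Data.Nat.Coprimality using (1-coprimeTo) renaming (sym to coprime-sym)

  i<1+∣i∣*d : ∀ i d → i ℤ.* + 1 ℤ.< + suc ∣ i ∣ ℤ.* + suc d
  i<1+∣i∣*d i d rewrite ℤₚ.*-identityʳ i = ℤₚ.≤-<-trans i≤∣i∣
    (ℤₚ.<-≤-trans (ℤ.+<+ (ℕₚ.n<1+n ∣ i ∣))
      (subst (+ suc ∣ i ∣ ℤ.≤_) (ℤₚ.pos-* (suc ∣ i ∣) (suc d))
        (ℤ.+≤+ (ℕₚ.m≤m*n (suc ∣ i ∣) (suc d)))))
    where
    i≤∣i∣ : ∀ {i} → i ℤ.≤ + ∣ i ∣
    i≤∣i∣ {+ n}        = ℤₚ.≤-refl
    i≤∣i∣ {ℤ.-[1+ n ]} = ℤ.-≤+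

  q<n : ∀ q → q ℚ.< + suc ∣ ℚ.↥ q ∣ / 1
  q<n q@(mkℚ i d _) = subst (q ℚ.<_)
    (sym (ℚₚ.normalize-coprime (coprime-sym (1-coprimeTo (suc ∣ i ∣)))))
    (*<* (i<1+∣i∣*d i d))

-- n raised to a positive real power x, as the infimum of the rational
-- powers n^(a/b) with x < a/b:  a rational s ≥ 0 satisfies n^(a/b) ≤ s
-- if and only if n^a ≤ s^b.
_^ℝ_ : ℕ → ℝ → ℝ
n ^ℝ x = record
  { Above     = λ q → ∃[ a ] ∃[ b ] ∃[ s ]
                  (Above x (+ a / suc b) × 0ℚ ℚ.≤ s ×
                   ℕ→ℚ (n ℕ.^ a) ℚ.≤ s ^ℚ suc b × s ℚ.< q)
  ; inhabited = let a , x<a = natAbove x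
                    s       = ℕ→ℚ (n ℕ.^ a)
                in s ℚ.+ 1ℚ , a , 0 , s , x<a ,
                   ℚₚ.nonNegative⁻¹ s {{ℚₚ.normalize-nonNeg (n ℕ.^ a) 1}} ,
                   ℚₚ.≤-reflexive (sym (ℚₚ.*-identityʳ s)) , q<q+1 s
  ; bounded   = 0ℚ , λ (_ , _ , _ , _ , 0≤s , _ , s<q) →
                  ℚₚ.<⇒≤ (ℚₚ.≤-<-trans 0≤s s<q)
  ; upward    = λ p<q (a , b , s , x<a/b , 0≤s , n^a≤s^b , s<p) →
                  a , b , s , x<a/b , 0≤s , n^a≤s^b , ℚₚ.<-trans s<p p<q
  ; open′     = λ (a , b , s , x<a/b , 0≤s , n^a≤s^b , s<q) →
                  let m , s<m , m<q = ℚₚ.<-dense s<q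
                  in m , m<q , a , b , s , x<a/b , 0≤s , n^a≤s^b , s<m
  }

------------------------------------------------------------------------
-- Finite simple graphs

record Graph : Set₁ where
  field
    order   : ℕ
    Adj     : Rel (Fin order) 0ℓ
    adj?    : B.Decidable Adj
    adj-sym : B.Symmetric Adj
    irrefl  : ∀ {v} → ¬ Adj v v

  V : Set
  V = Fin order

open Graph public using (V)

-- H is a subgraph of G, up to isomorphism; not necessarily induced.
infix 4 _⊑_
_⊑_ : Rel Graph 0ℓ
H ⊑ G = Σ (V H → V G) λ f →
  Injective _≡_ _≡_ f × (∀ {u v} → Graph.Adj H u v → Graph.Adj G (f u) (f v))

e : Graph → ℕ
e G = length (filter (λ (u , v) → (u Finₚ.<? v) ×-dec adj? u v)
                     (cartesianProduct (allFin order) (allFin order)))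
  where open Graph G

IsLeast : Pred ℕ 0ℓ → Pred ℕ 0ℓ
IsLeast P m = P m × (∀ j → P j → m ≤ j)

least : ∀ {P : Pred ℕ 0ℓ} → Decidable P → ∀ n → P n → ∃ (IsLeast P)
least P? n Pn with P? 0
least P? n       Pn | yes P0 = 0 , P0 , λ _ _ → z≤n
least P? zero    Pn | no ¬P0 = contradiction Pn ¬P0
least P? (suc n) Pn | no ¬P0 with least (P? ∘ suc) n Pn
... | m , Pm , min = suc m , Pm , λ where
  zero    P0 → contradiction P0 ¬P0
  (suc j) Pj → s≤s (min j Pj)

anyFun? : ∀ {m n} {P : Pred (Fin m → Fin n) 0ℓ} →
          (∀ {f g} → f ≗ g → P f → P g) → Decidable P → Dec (∃ P)
anyFun? resp P? = map′ (λ (i , p) → finToFun i , p)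
  (λ (f , p) → funToFin f , resp (sym ∘ finToFun-funToFin f) p)
  (any? (P? ∘ finToFun))

------------------------------------------------------------------------
-- Chromatic number

module _ (G : Graph) where
  open Graph G using (order; Adj; adj?; irrefl)

  ProperColouring : ∀ {k} → Pred (V G → Fin k) 0ℓ
  ProperColouring c = ∀ u v → Adj u v → c u ≢ c v

  Colourable : Pred ℕ 0ℓ
  Colourable k = ∃ (ProperColouring {k})

  colourable? : Decidable Colourable
  colourable? k = anyFun?
    (λ f≗g p u v uv gu≡gv → p u v uv (trans (f≗g u) (trans gu≡gv (sym (f≗g v)))))
    (λ c → all? λ u → all? λ v → adj? u v →-dec ¬? (c u ≟ᶠ c v))

  leastColouring : ∃ (IsLeast Colourable)
  leastColouring = least colourable? order
    (id , λ u v uv u≡v → irrefl (subst (Adj u) (sym u≡v) uv))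

  χ : ℕ
  χ = proj₁ leastColouring

------------------------------------------------------------------------
-- Girth

-- j follows i in the cyclic order 0, 1, …, ℓ-1, 0.
Next : ∀ {ℓ} → Rel (Fin ℓ) 0ℓ
Next {ℓ} i j = toℕ j ≡ suc (toℕ i) ⊎ (suc (toℕ i) ≡ ℓ × toℕ j ≡ 0)

module _ (G : Graph) where
  open Graph G using (order; Adj; adj?)

  IsCycle : ∀ {ℓ} → Pred (Fin ℓ → V G) 0ℓ
  IsCycle {ℓ} v = 3 ≤ ℓ × Injective _≡_ _≡_ v × (∀ i j → Next i j → Adj (v i) (v j))

  HasCycle : Pred ℕ 0ℓ
  HasCycle ℓ = ∃ (IsCycle {ℓ})

  data IsGirth : Pred (ℕ ⁺) 0ℓ where
    shortest : ∀ {ℓ} → IsLeast HasCycle ℓ → IsGirth [ ℓ ]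
    forest   : (∀ ℓ → ¬ HasCycle ℓ) → IsGirth ⊤⁺

  hasCycle? : Decidable HasCycle
  hasCycle? ℓ = anyFun?
    (λ f≗g (3≤ℓ , inj , adj) → 3≤ℓ ,
      (λ {i} {j} eq → inj (trans (f≗g i) (trans eq (sym (f≗g j))))) ,
      λ i j n → subst₂ Adj (f≗g i) (f≗g j) (adj i j n))
    (λ v → (3 ℕₚ.≤? ℓ) ×-dec
      map′ (λ h {i} {j} → h i j) (λ h i j → h {i} {j})
        (all? λ i → all? λ j → (v i ≟ᶠ v j) →-dec (i ≟ᶠ j)) ×-dec
      all? λ i → all? λ j →
        ((toℕ j ℕₚ.≟ suc (toℕ i)) ⊎-dec ((suc (toℕ i) ℕₚ.≟ ℓ) ×-dec (toℕ j ℕₚ.≟ 0)))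
        →-dec adj? (v i) (v j))

  girthExists : ∃ IsGirth
  girthExists with ℕₚ.anyUpTo? hasCycle? (suc order)
  ... | yes (ℓ , _ , c) = let m , isLeast = least hasCycle? ℓ c in [ m ] , shortest isLeast
  ... | no  none        = ⊤⁺ , forest λ ℓ c@(_ , _ , inj , _) →
                            none (ℓ , s≤s (injective⇒≤ inj) , c)

  girth : ℕ ⁺
  girth = proj₁ girthExists

open AddSup _≤_ public using (_≤⁺_)

{-# OPTIONS --safe #-}

-- Call G, with n vertices and maximum degree at most d, regular if every
-- k-colouring of its vertices leaves at least n d / q² ordered adjacent
-- pairs monochromatic, where q is a small power of χ(G).  If G is not
-- regular, a bad colouring and the degrees within its colour classes split
-- the vertices into 2k classes; one of them keeps a 1 / (2k) fraction of χ,
-- while n d drops by a factor q in every class.  As n d ≤ (2 e(G))² initially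
-- is polynomial in χ(G), after a bounded number of such passages one arrives
-- at a regular graph, where d is still at least a large power of q, because
-- d ≥ χ - 1.
--
-- In a regular graph keep each edge independently with probability 1 / D,
-- for D of the order of d / q².  On average there are at most n / 2 short
-- cycles, since n d^(ℓ-1) / D^ℓ is small against n, whereas with high
-- probability all kⁿ colourings retain more than n monochromatic edges.
-- Deleting an edge of every short cycle leaves the subgraph H.
module Submission where

open import Data.Bool.Base using (Bool; true; false; if_then_else_; _∧_)
open import Data.Fin.Base
  using (Fin; zero; suc; toℕ; fromℕ<; inject₁; inject≤; lower₁; combine; remQuot; _↑ˡ_; _↑ʳ_)
import Data.Fin.Properties as Finₚ
open Finₚ using () renaming (_≟_ to _≟ᶠ_)
import Data.Integer.Base as ℤ
import Data.Integer.Properties as ℤₚ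
open import Data.List.Base as List using (cartesianProduct; filter; length)
import Data.List.Properties as Listₚ
open import Data.Nat.Base hiding (_/_; _%_)
open import Data.Nat.Coprimality using (1-coprimeTo) renaming (sym to coprime-sym)
open import Data.Nat.DivMod using (_/_; _%_; m*n/n≡m; /-monoˡ-≤; m/n*n≤m; m≡m%n+[m/n]*n; m%n≤n)
open import Data.Nat.Properties
open import Data.Nat.Tactic.RingSolver using (solve-∀)
open import Data.Product.Base using (∃; ∃-syntax; _×_; _,_; proj₁; proj₂)
open import Data.Rational.Base using (mkℚ; *<*)
import Data.Rational.Base as ℚ
import Data.Rational.Properties as ℚₚ
open import Data.Sum.Base using (_⊎_; inj₁; inj₂)
open import Data.Vec.Base using (Vec; []; _∷_; lookup; tabulate)
open import Data.Vec.Properties using (lookup∘tabulate)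
open import Function.Base using (_∘_; id)
open import Function.Definitions using (Injective)
open import Level using (0ℓ)
open import Relation.Binary.Core using (Rel)
import Relation.Binary.Construct.Add.Supremum.NonStrict as AddSup
import Relation.Binary.Definitions as B
open import Relation.Binary.PropositionalEquality
  using (_≡_; _≢_; _≗_; refl; sym; trans; cong; cong₂; subst; subst₂; module ≡-Reasoning)
open import Relation.Nullary using (Dec; yes; no; ¬_; does; contradiction)
open import Relation.Nullary.Decidable
  using (_×-dec_; _⊎-dec_; _→-dec_; map′; dec-true; dec-false)
open import Relation.Unary using (Pred; Decidable)
open import Algebra.Properties.CommutativeSemigroup *-commutativeSemigroup
  using (interchange; x∙yz≈y∙xz; x∙yz≈yx∙z)
open import Algebra.Properties.Semiring.Sum +-*-semiring
  using (sum; sum-syntax; sum-cong-≗; ∑-distrib-+; ∑-comm; *-distribˡ-sum; *-distribʳ-sum)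
open import Defs

-- Indicators, finite sums and products

⟦_⟧ : Bool → ℕ
⟦ b ⟧ = if b then 1 else 0

𝟙 : {P : Set} → Dec P → ℕ
𝟙 P? = ⟦ does P? ⟧

𝟙-true : {P : Set} (P? : Dec P) → P → 𝟙 P? ≡ 1
𝟙-true (yes _) _ = refl
𝟙-true (no ¬p) p = contradiction p ¬p

𝟙-false : {P : Set} (P? : Dec P) → ¬ P → 𝟙 P? ≡ 0
𝟙-false (yes p) ¬p = contradiction p ¬p
𝟙-false (no _) _ = refl

𝟙-mono : {P Q : Set} (P? : Dec P) (Q? : Dec Q) → (P → Q) → 𝟙 P? ≤ 𝟙 Q?
𝟙-mono (yes p) Q? f = ≤-reflexive (sym (𝟙-true Q? (f p)))
𝟙-mono (no _)  Q? f = z≤n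

𝟙-≤ : {P : Set} (P? : Dec P) {m : ℕ} → (P → 1 ≤ m) → 𝟙 P? ≤ m
𝟙-≤ (yes p) 1≤m = 1≤m p
𝟙-≤ (no _)  1≤m = z≤n

𝟙∧-≤ : {P : Set} (P? : Dec P) {s : Bool} {m : ℕ} → (P → s ≡ true → 1 ≤ m) → ⟦ does P? ∧ s ⟧ ≤ m
𝟙∧-≤ (yes p) {true}  1≤m = 1≤m p refl
𝟙∧-≤ (yes _) {false} 1≤m = z≤n
𝟙∧-≤ (no _)          1≤m = z≤n

if-does : {P A : Set} (P? : Dec P) {a b c : A} → (P → a ≡ c) → b ≡ c → (if does P? then a else b) ≡ c
if-does (yes p) a≡c b≡c = a≡c p
if-does (no _)  a≡c b≡c = b≡c

𝟙-exclusive : {P Q : Set} (P? : Dec P) (Q? : Dec Q) → (P → ¬ Q) → 𝟙 P? + 𝟙 Q? ≤ 1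
𝟙-exclusive (yes p) (yes q) excl = contradiction q (excl p)
𝟙-exclusive (yes _) (no _)  excl = ≤-refl
𝟙-exclusive (no _)  (yes _) excl = ≤-refl
𝟙-exclusive (no _)  (no _)  excl = z≤n

sum-mono : ∀ {n} {f g : Fin n → ℕ} → (∀ i → f i ≤ g i) → sum f ≤ sum g
sum-mono {zero}  f≤g = z≤n
sum-mono {suc n} f≤g = +-mono-≤ (f≤g zero) (sum-mono (f≤g ∘ suc))

sum-const : ∀ n c → ∑[ _ < n ] c ≡ n * c
sum-const zero    c = refl
sum-const (suc n) c = cong (c +_) (sum-const n c)

sum-bounded : ∀ {n} {f : Fin n → ℕ} {c} → (∀ i → f i ≤ c) → sum f ≤ n * c
sum-bounded {n} {c = c} f≤c = ≤-trans (sum-mono f≤c) (≤-reflexive (sum-const n c))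

term≤sum : ∀ {n} (f : Fin n → ℕ) i → f i ≤ sum f
term≤sum f zero    = m≤m+n _ _
term≤sum f (suc i) = ≤-trans (term≤sum (f ∘ suc) i) (m≤n+m _ _)

sum-𝟙-unique : ∀ {n} {P : Pred (Fin n) 0ℓ} (P? : Decidable P) →
               (∀ {i j} → P i → P j → i ≡ j) → ∑[ i < n ] 𝟙 (P? i) ≤ 1
sum-𝟙-unique {zero}  P? unique = z≤n
sum-𝟙-unique {suc n} P? unique with P? zero
... | no  _  = sum-𝟙-unique (P? ∘ suc) (λ p q → Finₚ.suc-injective (unique p q))
... | yes p₀ = s≤s (≤-trans (sum-bounded {c = 0} λ i →
                 ≤-reflexive (𝟙-false (P? (suc i)) (Finₚ.0≢1+n ∘ unique p₀)))
                 (≤-reflexive (*-zeroʳ n)))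

-- Double counting: with `h (ι j)` spread over the indicators `𝟙 (ι j ≟ᶠ i)` and the sum over `j`
-- taken first, each `h i` is met at most once, since `i` has at most one preimage.
sum-injective : ∀ {m n} {ι : Fin m → Fin n} → Injective _≡_ _≡_ ι →
                (h : Fin n → ℕ) → ∑[ j < m ] h (ι j) ≤ sum h
sum-injective {m} {n} {ι} ι-inj h = begin
  ∑[ j < m ] h (ι j)                              ≤⟨ sum-mono (λ j →
    ≤-trans (≤-reflexive (sym (trans (cong (_* h (ι j)) (𝟙-true (ι j ≟ᶠ ι j) refl)) (*-identityˡ _))))
            (term≤sum (λ i → 𝟙 (ι j ≟ᶠ i) * h i) (ι j))) ⟩
  ∑[ j < m ] ∑[ i < n ] (𝟙 (ι j ≟ᶠ i) * h i)      ≡⟨ ∑-comm (λ j i → 𝟙 (ι j ≟ᶠ i) * h i) ⟩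
  ∑[ i < n ] ∑[ j < m ] (𝟙 (ι j ≟ᶠ i) * h i)      ≤⟨ sum-mono (λ i → begin
    ∑[ j < m ] (𝟙 (ι j ≟ᶠ i) * h i)   ≡⟨ *-distribʳ-sum (h i) (λ j → 𝟙 (ι j ≟ᶠ i)) ⟨
    (∑[ j < m ] 𝟙 (ι j ≟ᶠ i)) * h i   ≤⟨ *-monoˡ-≤ (h i) (sum-𝟙-unique (λ j → ι j ≟ᶠ i)
                                          (λ p q → ι-inj (trans p (sym q)))) ⟩
    1 * h i                           ≡⟨ *-identityˡ (h i) ⟩
    h i                               ∎) ⟩
  sum h                                           ∎
  where open ≤-Reasoning

sum-++ : ∀ m {n} (h : Fin (m + n) → ℕ) →
         sum h ≡ ∑[ i < m ] h (i ↑ˡ n) + ∑[ j < n ] h (m ↑ʳ j)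
sum-++ zero    h = refl
sum-++ (suc m) h = trans (cong (h zero +_) (sum-++ m (h ∘ suc))) (sym (+-assoc (h zero) _ _))

sum-combine : ∀ m n (h : Fin (m * n) → ℕ) →
              sum h ≡ ∑[ u < m ] ∑[ v < n ] h (combine u v)
sum-combine zero    n h = refl
sum-combine (suc m) n h =
  trans (sum-++ n h) (cong (∑[ v < n ] h (v ↑ˡ m * n) +_) (sum-combine m n (h ∘ (n ↑ʳ_))))

sum<⇒∃ : ∀ {n} (f : Fin n → ℕ) c → sum f < n * c → ∃[ i ] f i < c
sum<⇒∃ {suc n} f c Σf<nc with f zero <? c
... | yes f₀<c = zero , f₀<c
... | no  f₀≮c = let i , fᵢ<c = sum<⇒∃ (f ∘ suc) c (+-cancelˡ-< c _ _
                       (≤-<-trans (+-monoˡ-≤ _ (≮⇒≥ f₀≮c)) Σf<nc))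
                 in suc i , fᵢ<c

product : ∀ {n} → (Fin n → ℕ) → ℕ
product {zero}  f = 1
product {suc n} f = f zero * product (f ∘ suc)

product-cong : ∀ {n} {f g : Fin n → ℕ} → f ≗ g → product f ≡ product g
product-cong {zero}  f≗g = refl
product-cong {suc n} f≗g = cong₂ _*_ (f≗g zero) (product-cong (f≗g ∘ suc))

-- The extra factor `b ^ s`, for `s` the number of positions in `S`, avoids the truncated exponent
-- in a^s b^(n-s).
product-two-valued : ∀ {n} (S : Fin n → Bool) a b →
  product (λ i → if S i then a else b) * b ^ (∑[ i < n ] ⟦ S i ⟧) ≡
  a ^ (∑[ i < n ] ⟦ S i ⟧) * b ^ n
product-two-valued {zero}  S a b = refl
product-two-valued {suc n} S a b with S zero | product-two-valued (S ∘ suc) a b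
... | true  | eq = begin
  a * p * (b * b ^ s)      ≡⟨ regroup₁ a p b (b ^ s) ⟩
  a * b * (p * b ^ s)      ≡⟨ cong (a * b *_) eq ⟩
  a * b * (a ^ s * b ^ n)  ≡⟨ regroup₂ a b (a ^ s) (b ^ n) ⟩
  a * a ^ s * (b * b ^ n)  ∎
  where
  open ≡-Reasoning
  p = product (λ i → if S (suc i) then a else b)
  s = ∑[ i < n ] ⟦ S (suc i) ⟧
  regroup₁ : ∀ a p b x → a * p * (b * x) ≡ a * b * (p * x)
  regroup₁ = solve-∀
  regroup₂ : ∀ a b x y → a * b * (x * y) ≡ a * x * (b * y)
  regroup₂ = solve-∀
... | false | eq = begin
  b * p * b ^ s      ≡⟨ *-assoc b p (b ^ s) ⟩
  b * (p * b ^ s)    ≡⟨ cong (b *_) eq ⟩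
  b * (a ^ s * b ^ n)  ≡⟨ x∙yz≈y∙xz b (a ^ s) (b ^ n) ⟩
  a ^ s * (b * b ^ n)  ∎
  where
  open ≡-Reasoning
  p = product (λ i → if S (suc i) then a else b)
  s = ∑[ i < n ] ⟦ S (suc i) ⟧

product-one : ∀ {n} (f : Fin n → ℕ) → (∀ i → f i ≡ 1) → product f ≡ 1
product-one {zero}  f f≡1 = refl
product-one {suc n} f f≡1 = cong₂ _*_ (f≡1 zero) (product-one (f ∘ suc) (f≡1 ∘ suc))

-- Sums over words

sumVec : ∀ {a} l → (Vec (Fin a) l → ℕ) → ℕ
sumVec         zero    g = g []
sumVec {a} (suc l) g = ∑[ x < a ] sumVec l (λ w → g (x ∷ w))

sumVec-cong : ∀ {a} l {f g : Vec (Fin a) l → ℕ} → f ≗ g → sumVec l f ≡ sumVec l g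
sumVec-cong zero    f≗g = f≗g []
sumVec-cong (suc l) f≗g = sum-cong-≗ λ x → sumVec-cong l (λ w → f≗g (x ∷ w))

sumVec-mono : ∀ {a} l {f g : Vec (Fin a) l → ℕ} → (∀ w → f w ≤ g w) → sumVec l f ≤ sumVec l g
sumVec-mono zero    f≤g = f≤g []
sumVec-mono (suc l) f≤g = sum-mono λ x → sumVec-mono l (λ w → f≤g (x ∷ w))

sumVec-const : ∀ {a} l c → sumVec {a} l (λ _ → c) ≡ a ^ l * c
sumVec-const     zero    c = sym (+-identityʳ c)
sumVec-const {a} (suc l) c = begin
  ∑[ x < a ] sumVec {a} l (λ _ → c)  ≡⟨ sum-const a _ ⟩
  a * sumVec {a} l (λ _ → c)         ≡⟨ cong (a *_) (sumVec-const l c) ⟩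
  a * (a ^ l * c)                    ≡⟨ *-assoc a (a ^ l) c ⟨
  a ^ suc l * c                      ∎
  where open ≡-Reasoning

term≤sumVec : ∀ {a l} (g : Vec (Fin a) l → ℕ) w → g w ≤ sumVec l g
term≤sumVec g []      = ≤-refl
term≤sumVec g (x ∷ w) = ≤-trans (term≤sumVec (λ w → g (x ∷ w)) w) (term≤sum (λ x → sumVec _ (λ w → g (x ∷ w))) x)

sumVec-+ : ∀ {a} l (f g : Vec (Fin a) l → ℕ) →
           sumVec l (λ w → f w + g w) ≡ sumVec l f + sumVec l g
sumVec-+ zero    f g = refl
sumVec-+ (suc l) f g = trans (sum-cong-≗ λ x → sumVec-+ l (λ w → f (x ∷ w)) (λ w → g (x ∷ w)))
                             (∑-distrib-+ (λ x → sumVec l (λ w → f (x ∷ w))) _)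

sumVec-*ˡ : ∀ {a} l c (g : Vec (Fin a) l → ℕ) → sumVec l (λ w → c * g w) ≡ c * sumVec l g
sumVec-*ˡ zero    c g = refl
sumVec-*ˡ {a} (suc l) c g = trans (sum-cong-≗ λ x → sumVec-*ˡ l c (λ w → g (x ∷ w)))
                              (sym (*-distribˡ-sum {a} c λ x → sumVec l (λ w → g (x ∷ w))))

sumVec-sum : ∀ {a} l {n} (g : Fin n → Vec (Fin a) l → ℕ) →
             sumVec l (λ w → ∑[ i < n ] g i w) ≡ ∑[ i < n ] sumVec l (g i)
sumVec-sum     zero    g = refl
sumVec-sum {a} (suc l) {n} g = trans (sum-cong-≗ λ x → sumVec-sum l (λ i w → g i (x ∷ w)))
                                     (∑-comm {a} {n} λ x i → sumVec l (λ w → g i (x ∷ w)))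

sumVec-comm : ∀ {a b} l m (g : Vec (Fin a) l → Vec (Fin b) m → ℕ) →
              sumVec l (λ v → sumVec m (g v)) ≡ sumVec m (λ w → sumVec l (λ v → g v w))
sumVec-comm zero    m g = refl
sumVec-comm {a} (suc l) m g = trans (sum-cong-≗ λ x → sumVec-comm l m (λ v → g (x ∷ v)))
                                    (sym (sumVec-sum m (λ x w → sumVec l (λ v → g (x ∷ v) w))))

-- Distributivity, one letter at a time. For the uniform distribution on words this is the product
-- rule for expectations of independent factors.
sumVec-product : ∀ {a} l (h : Fin l → Fin a → ℕ) →
                 sumVec l (λ w → product (λ i → h i (lookup w i))) ≡ product (λ i → sum (h i))
sumVec-product zero    h = refl
sumVec-product {a} (suc l) h = begin
  ∑[ x < a ] sumVec l (λ w → h zero x * product (λ i → h (suc i) (lookup w i)))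
    ≡⟨ (sum-cong-≗ λ x → sumVec-*ˡ l (h zero x) _) ⟩
  ∑[ x < a ] (h zero x * sumVec l (λ w → product (λ i → h (suc i) (lookup w i))))
    ≡⟨ (sum-cong-≗ λ x → cong (h zero x *_) (sumVec-product l (h ∘ suc))) ⟩
  ∑[ x < a ] (h zero x * product (λ i → sum (h (suc i))))
    ≡⟨ *-distribʳ-sum _ (h zero) ⟨
  sum (h zero) * product (λ i → sum (h (suc i))) ∎
  where open ≡-Reasoning

-- The first moment method: an average below `c` forces a value below `c`, found letter by letter.
sumVec<⇒∃ : ∀ {a} l (g : Vec (Fin a) l → ℕ) c → sumVec l g < a ^ l * c → ∃[ w ] g w < c
sumVec<⇒∃ zero    g c lt = [] , subst (g [] <_) (+-identityʳ c) lt
sumVec<⇒∃ {a} (suc l) g c lt =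
  let x , lt′ = sum<⇒∃ (λ x → sumVec l (λ w → g (x ∷ w))) (a ^ l * c)
                  (<-≤-trans lt (≤-reflexive (*-assoc a (a ^ l) c)))
      w , gw<c = sumVec<⇒∃ l (λ w → g (x ∷ w)) c lt′
  in x ∷ w , gw<c

-- Induced subgraphs, degrees and colourings

record Enumeration {n} (S : Pred (Fin n) 0ℓ) : Set where
  field
    size      : ℕ
    element   : Fin size → Fin n
    injective : Injective _≡_ _≡_ element
    sound     : ∀ j → S (element j)
    complete  : ∀ {v} → S v → ∃[ j ] element j ≡ v

enumerate : ∀ {n} {S : Pred (Fin n) 0ℓ} → Decidable S → Enumeration S
enumerate {zero} S? = record
  { size = 0 ; element = λ () ; injective = λ { {()} } ; sound = λ () ; complete = λ { {()} } }
enumerate {suc n} S? with S? zero | enumerate (S? ∘ suc)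
... | no ¬S₀ | E = record
  { size      = size
  ; element   = suc ∘ element
  ; injective = injective ∘ Finₚ.suc-injective
  ; sound     = sound
  ; complete  = λ { {zero}  S₀ → contradiction S₀ ¬S₀
                  ; {suc v} Sv → let j , eq = complete Sv in j , cong suc eq }
  }
  where open Enumeration E
... | yes S₀ | E = record
  { size      = suc size
  ; element   = λ { zero → zero ; (suc j) → suc (element j) }
  ; injective = λ { {zero}  {zero}  _  → refl
                  ; {suc _} {suc _} eq → cong suc (injective (Finₚ.suc-injective eq)) }
  ; sound     = λ { zero → S₀ ; (suc j) → sound j }
  ; complete  = λ { {zero}  _  → zero , refl
                  ; {suc v} Sv → let j , eq = complete Sv in suc j , cong suc eq }
  }
  where open Enumeration E

module _ (G : Graph) where
  open Graph G hiding (V)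

  degree : V G → ℕ
  degree u = ∑[ v < order ] 𝟙 (adj? u v)

  monoDegree : ∀ {k} → (V G → Fin k) → V G → ℕ
  monoDegree f u = ∑[ v < order ] 𝟙 (adj? u v ×-dec f u ≟ᶠ f v)

  monoPairs : ∀ {k} → (V G → Fin k) → ℕ
  monoPairs f = ∑[ u < order ] monoDegree f u

  MaxDegree : ℕ → Set
  MaxDegree d = ∀ u → degree u ≤ d

  induced : {S : Pred (V G) 0ℓ} → Decidable S → Graph
  induced S? = record
    { order   = size
    ; Adj     = λ u v → Adj (element u) (element v)
    ; adj?    = λ u v → adj? (element u) (element v)
    ; adj-sym = adj-sym
    ; irrefl  = irrefl
    }
    where open Enumeration (enumerate S?)

  induced⊑ : {S : Pred (V G) 0ℓ} (S? : Decidable S) → induced S? ⊑ G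
  induced⊑ S? = element , injective , id
    where open Enumeration (enumerate S?)

  order-induced : {S : Pred (V G) 0ℓ} (S? : Decidable S) (h : V G → ℕ) →
                  (∀ {v} → S v → 1 ≤ h v) → Graph.order (induced S?) ≤ sum h
  order-induced S? h 1≤h = begin
    size                            ≡⟨ trans (sum-const size 1) (*-identityʳ size) ⟨
    ∑[ j < size ] 1                 ≤⟨ sum-mono (λ j → 1≤h (sound j)) ⟩
    ∑[ j < size ] h (element j)     ≤⟨ sum-injective injective h ⟩
    sum h                           ∎
    where
    open Enumeration (enumerate S?)
    open ≤-Reasoning

  colourable-mono : ∀ {s t} → s ≤ t → Colourable G s → Colourable G t
  colourable-mono s≤t (c , proper) = (λ v → inject≤ (c v) s≤t) ,
    λ u v uv eq → proper u v uv (Finₚ.inject≤-injective s≤t s≤t (c u) (c v) eq)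

  -- A vertex is coloured by its class together with its colour there: edges between classes differ
  -- in the first component, edges inside a class in the second.
  colour-by-class : ∀ {c t} (p : V G → Fin c) →
    (∀ i → Colourable (induced (λ v → p v ≟ᶠ i)) t) → Colourable G (c * t)
  colour-by-class {c} {t} p hyp =
    (λ v → combine (p v) (colour (p v) v refl)) ,
    λ u v uv eq → let eq₁ , eq₂ = Finₚ.combine-injective _ _ _ _ eq
                  in proper u v uv _ _ refl refl eq₁ eq₂
    where
    index : ∀ i v → p v ≡ i → _
    index i v pv≡i = Enumeration.complete (enumerate (λ v → p v ≟ᶠ i)) pv≡i

    colour : ∀ i v → p v ≡ i → Fin t
    colour i v pv≡i = proj₁ (hyp i) (proj₁ (index i v pv≡i))

    -- The classes stay variables with equality proofs, so that matching on `i ≡ j` puts both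
    -- endpoints into one class.
    proper : ∀ u v → Adj u v → ∀ i j (pu≡i : p u ≡ i) (pv≡j : p v ≡ j) →
             i ≡ j → colour i u pu≡i ≢ colour j v pv≡j
    proper u v uv i .i pu≡i pv≡i refl = proj₂ (hyp i) _ _
      (subst₂ Adj (sym (proj₂ (index i u pu≡i))) (sym (proj₂ (index i v pv≡i))) uv)

  -- The contrapositive of `colour-by-class`; colourability is decidable and the classes are finite
  -- in number, so a class is actually found.
  uncolourable-class : ∀ {c t} (p : V G → Fin c) → ¬ Colourable G (c * t) →
    ∃[ i ] ¬ Colourable (induced (λ v → p v ≟ᶠ i)) t
  uncolourable-class {c} {t} p ¬col =
    Finₚ.¬∀⟶∃¬ c (λ i → Colourable (induced (λ v → p v ≟ᶠ i)) t)
      (λ i → colourable? (induced (λ v → p v ≟ᶠ i)) t) (¬col ∘ colour-by-class p)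

-- Vertex `zero` is coloured last: its at most `d` neighbours leave one of `suc d` colours free. A
-- bare relation on `Fin n` lets the induction restrict along `suc`.
greedy-colouring : ∀ {n d} {_~_ : Rel (Fin n) 0ℓ} (_~?_ : B.Decidable _~_) →
  B.Symmetric _~_ → (∀ {v} → ¬ v ~ v) → (∀ u → ∑[ v < n ] 𝟙 (u ~? v) ≤ d) →
  ∃ λ (c : Fin n → Fin (suc d)) → ∀ u v → u ~ v → c u ≢ c v
greedy-colouring {zero} _~?_ ~-sym ~-irrefl Δ≤d = (λ ()) , λ ()
greedy-colouring {suc n} {d} {_~_} _~?_ ~-sym ~-irrefl Δ≤d = colour , proper
  where
  tail : ∃ λ (c : Fin n → Fin (suc d)) → ∀ u v → suc u ~ suc v → c u ≢ c v
  tail = greedy-colouring (λ u v → suc u ~? suc v) ~-sym ~-irrefl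
    (λ u → ≤-trans (m≤n+m _ _) (Δ≤d (suc u)))

  c = proj₁ tail

  Used : Fin (suc d) → Set
  Used x = ∃[ v ] (zero ~ suc v × c v ≡ x)

  -- A neighbour chosen for every colour would give `suc d` distinct neighbours of `zero`.
  not-all-used : ¬ (∀ x → Used x)
  not-all-used used = <-irrefl refl (begin
    suc d                                        ≡⟨ trans (sum-const (suc d) 1) (*-identityʳ (suc d)) ⟨
    ∑[ x < suc d ] 1                             ≡⟨ (sum-cong-≗ λ x → 𝟙-true (zero ~? suc (user x)) (proj₁ (proj₂ (used x)))) ⟨
    ∑[ x < suc d ] 𝟙 (zero ~? suc (user x))      ≤⟨ sum-injective user-inj (λ v → 𝟙 (zero ~? suc v)) ⟩
    ∑[ v < n ] 𝟙 (zero ~? suc v)                 ≤⟨ m≤n+m _ _ ⟩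
    ∑[ v < suc n ] 𝟙 (zero ~? v)                 ≤⟨ Δ≤d zero ⟩
    d                                            ∎)
    where
    open ≤-Reasoning
    user : Fin (suc d) → Fin n
    user x = proj₁ (used x)
    user-inj : Injective _≡_ _≡_ user
    user-inj {x} {y} eq = trans (sym (proj₂ (proj₂ (used x)))) (trans (cong c eq) (proj₂ (proj₂ (used y))))

  free : ∃[ x ] ¬ Used x
  free = Finₚ.¬∀⟶∃¬ (suc d) Used
    (λ x → Finₚ.any? λ v → (zero ~? suc v) ×-dec (c v ≟ᶠ x)) not-all-used

  colour : Fin (suc n) → Fin (suc d)
  colour zero    = proj₁ free
  colour (suc v) = c v

  proper : ∀ u v → u ~ v → colour u ≢ colour v
  proper zero    zero    uv eq = ~-irrefl uv
  proper zero    (suc v) uv eq = proj₂ free (v , uv , sym eq)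
  proper (suc u) zero    uv eq = proj₂ free (u , ~-sym uv , eq)
  proper (suc u) (suc v) uv eq = proj₂ tail u v uv eq

-- Greedy colouring read backwards. It keeps the degree bound large in every subgraph that still
-- needs many colours.
uncolourable⇒≤maxDegree : ∀ G {d t} → MaxDegree G d → ¬ Colourable G t → t ≤ d
uncolourable⇒≤maxDegree G {d} {t} Δ≤d ¬col with t ≤? d
... | yes t≤d = t≤d
... | no  t≰d = contradiction
  (colourable-mono G (≰⇒> t≰d) (greedy-colouring adj? adj-sym irrefl Δ≤d)) ¬col
  where open Graph G hiding (V)

-- Passing to a regular subgraph

side : {P : Set} → Dec P → Fin 2
side (yes _) = suc zero
side (no _)  = zero

side-zero : {P : Set} (P? : Dec P) → side P? ≡ zero → ¬ P
side-zero (no ¬p) _ = ¬p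

side-one : {P : Set} (P? : Dec P) → side P? ≡ suc zero → P
side-one (yes p) _ = p

module _ (G : Graph) {k q d : ℕ} .{{_ : NonZero q}}
         (Δ≤d : MaxDegree G d) (f : V G → Fin k)
         (few : monoPairs G f * (q * q) < Graph.order G * d) where
  open Graph G hiding (V)

  private
    high : V G → Fin 2
    high v = side (d ≤? monoDegree G f v * q)

    high-low : ∀ {v} → high v ≡ zero → monoDegree G f v * q ≤ d
    high-low {v} eq = <⇒≤ (≰⇒> (side-zero (d ≤? monoDegree G f v * q) eq))

    high-high : ∀ {v} → high v ≡ suc zero → d ≤ monoDegree G f v * q
    high-high {v} eq = side-one (d ≤? monoDegree G f v * q) eq

    p : V G → Fin (k * 2)
    p v = combine (f v) (high v)

    class : Fin (k * 2) → Graph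
    class i = induced G (λ v → p v ≟ᶠ i)

    module _ (i : Fin (k * 2)) where
      open Enumeration (enumerate (λ v → p v ≟ᶠ i))

      p≡i⇒high : ∀ {v} → p v ≡ i → high v ≡ proj₂ (remQuot {k} 2 i)
      p≡i⇒high {v} pv≡i = trans (sym (cong proj₂ (Finₚ.remQuot-combine (f v) (high v))))
                                (cong (proj₂ ∘ remQuot {k} 2) pv≡i)

      p≡i⇒f : ∀ u v → p u ≡ i → p v ≡ i → f u ≡ f v
      p≡i⇒f u v pu≡i pv≡i = Finₚ.combine-injectiveˡ (f u) (high u) (f v) (high v)
                              (trans pu≡i (sym pv≡i))

      degree-class : ∀ j → degree (class i) j ≤ monoDegree G f (element j)
      degree-class j = ≤-trans
        (sum-mono (λ l → 𝟙-mono (adj? _ _) (adj? _ _ ×-dec (f _ ≟ᶠ f _))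
          (λ uv → uv , p≡i⇒f _ _ (sound j) (sound l))))
        (sum-injective injective (λ v → 𝟙 (adj? (element j) v ×-dec f (element j) ≟ᶠ f v)))

      -- Markov's inequality with the division by `q` cleared.
      order-high : proj₂ (remQuot {k} 2 i) ≡ suc zero → size * d ≤ monoPairs G f * q
      order-high eq = begin
        size * d                                     ≡⟨ sum-const size d ⟨
        ∑[ j < size ] d                              ≤⟨ sum-mono (λ j → high-high (trans (p≡i⇒high (sound j)) eq)) ⟩
        ∑[ j < size ] (monoDegree G f (element j) * q) ≤⟨ sum-injective injective (λ v → monoDegree G f v * q) ⟩
        ∑[ v < order ] (monoDegree G f v * q)        ≡⟨ *-distribʳ-sum q (monoDegree G f) ⟨
        monoPairs G f * q                            ∎
        where open ≤-Reasoning

      -- In a low class the degrees fall to `d / q` and the order is at most that of `G`; in a high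
      -- class `d` stays, and `order-high` with `few` cuts the order by `q`.
      class-bounds : ∃[ d′ ] (MaxDegree (class i) d′ × size * d′ * q ≤ order * d)
      class-bounds with proj₂ (remQuot {k} 2 i) in eq
      ... | zero = d / q ,
        (λ j → ≤-trans (degree-class j) (begin
          monoDegree G f (element j)          ≡⟨ m*n/n≡m _ q ⟨
          monoDegree G f (element j) * q / q  ≤⟨ /-monoˡ-≤ q (high-low (trans (p≡i⇒high (sound j)) eq)) ⟩
          d / q                               ∎)) ,
        (begin
          size * (d / q) * q    ≡⟨ *-assoc size (d / q) q ⟩
          size * (d / q * q)    ≤⟨ *-mono-≤ (Finₚ.injective⇒≤ injective) (m/n*n≤m d q) ⟩
          order * d             ∎)
        where open ≤-Reasoning
      ... | suc zero = d ,
        (λ j → ≤-trans (sum-injective injective (λ v → 𝟙 (adj? (element j) v))) (Δ≤d (element j))) ,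
        (begin
          size * d * q              ≤⟨ *-monoˡ-≤ q (order-high eq) ⟩
          monoPairs G f * q * q     ≡⟨ *-assoc (monoPairs G f) q q ⟩
          monoPairs G f * (q * q)   <⟨ few ⟩
          order * d                 ∎)
        where open ≤-Reasoning

  -- Each vertex with at least d / q neighbours of its own colour uses up
  -- d / q of the few monochromatic pairs, so the vertices of this kind are
  -- at most a 1 / q fraction; among the others the degree drops by q.
  pass-to-class : ∀ {t} → ¬ Colourable G (k * 2 * t) →
    ∃[ G′ ] ∃[ d′ ] (G′ ⊑ G × MaxDegree G′ d′ × ¬ Colourable G′ t ×
                     Graph.order G′ * d′ * q ≤ order * d)
  pass-to-class ¬col =
    let i , ¬colᵢ         = uncolourable-class G p ¬col
        d′ , Δ≤d′ , bound = class-bounds i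
    in class i , d′ , induced⊑ G _ , Δ≤d′ , ¬colᵢ , bound

⊑-refl : ∀ {G} → G ⊑ G
⊑-refl = id , id , id

⊑-trans : ∀ {F G H} → F ⊑ G → G ⊑ H → F ⊑ H
⊑-trans (f , f-inj , f-hom) (g , g-inj , g-hom) = g ∘ f , f-inj ∘ g-inj , g-hom ∘ f-hom

Regular : (G : Graph) (k q d : ℕ) → Set
Regular G k q d = ∀ (f : V G → Fin k) → Graph.order G * d ≤ monoPairs G f * (q * q)

monoPairs-cong : ∀ G {k} {f g : V G → Fin k} → f ≗ g → monoPairs G f ≡ monoPairs G g
monoPairs-cong G {f = f} {g} f≗g = sum-cong-≗ λ u → sum-cong-≗ λ v →
  cong₂ (λ x y → 𝟙 (Graph.adj? G u v ×-dec x ≟ᶠ y)) (f≗g u) (f≗g v)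

-- `J` bounds the number of passages: each divides order times degree bound by at least `q`, and
-- `(k * 2) ^ J` pays for the chromatic loss. Once the product is below `1` it is `0`, and
-- regularity is trivial.
regularise : ∀ {k q} .{{_ : NonZero k}} .{{_ : NonZero q}} {t} J G {d} →
  MaxDegree G d → ¬ Colourable G ((k * 2) ^ J * t) → Graph.order G * d < q ^ J →
  ∃[ G′ ] ∃[ d′ ] (G′ ⊑ G × MaxDegree G′ d′ × ¬ Colourable G′ t × Regular G′ k q d′)
regularise {t = t} zero G {d} Δ≤d ¬col nd<1 =
  G , d , ⊑-refl {G} , Δ≤d , ¬col ∘ colourable-mono G (m≤n*m t 1) ,
  λ f → ≤-trans (≤-pred nd<1) z≤n
regularise {k} {q} {t = t} (suc J) G {d} Δ≤d ¬col nd<q^J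
  -- Colourings are finite in number, so either an explicit one violates regularity or none does.
  with anyFun? (λ f≗g few → subst (λ s → s * (q * q) < _) (monoPairs-cong G f≗g) few)
               (λ (f : V G → Fin k) → monoPairs G f * (q * q) <? Graph.order G * d)
... | no  none = G , d , ⊑-refl {G} , Δ≤d ,
  ¬col ∘ colourable-mono G (m≤n*m t ((k * 2) ^ suc J) {{m^n≢0 (k * 2) (suc J) {{m*n≢0 k 2}}}}) ,
  λ f → ≮⇒≥ (λ few → none (f , few))
... | yes (f , few) =
  let G₁ , d₁ , G₁⊑G , Δ≤d₁ , ¬col₁ , bound =
        pass-to-class G {q = q} Δ≤d f few {(k * 2) ^ J * t}
          (¬col ∘ subst (Colourable G) (sym (*-assoc (k * 2) ((k * 2) ^ J) t)))
      G₂ , d₂ , G₂⊑G₁ , rest = regularise J G₁ Δ≤d₁ ¬col₁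
        (*-cancelʳ-< q _ _ (≤-<-trans bound (<-≤-trans nd<q^J (≤-reflexive (*-comm q (q ^ J))))))
  in G₂ , d₂ , ⊑-trans {G₂} {G₁} {G} G₂⊑G₁ G₁⊑G , rest

-- Edge counts and isolated vertices

-- Each related pair is counted through its increasing orientation, and the diagonal is empty. It
-- serves both adjacency and monochromatic adjacency.
sum-symmetric : ∀ {n} {R : Rel (Fin n) 0ℓ} (R? : B.Decidable R) →
  B.Symmetric R → (∀ {v} → ¬ R v v) →
  ∑[ u < n ] ∑[ v < n ] 𝟙 (R? u v) ≤ 2 * ∑[ u < n ] ∑[ v < n ] 𝟙 ((u Finₚ.<? v) ×-dec R? u v)
sum-symmetric {n} {R} R? R-sym R-irrefl = begin
  ∑[ u < n ] ∑[ v < n ] 𝟙 (R? u v)                ≤⟨ sum-mono (λ u → sum-mono (split u)) ⟩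
  ∑[ u < n ] ∑[ v < n ] (a u v + a v u)           ≡⟨ (sum-cong-≗ λ u → ∑-distrib-+ (a u) (λ v → a v u)) ⟩
  ∑[ u < n ] (∑[ v < n ] a u v + ∑[ v < n ] a v u) ≡⟨ ∑-distrib-+ (λ u → ∑[ v < n ] a u v) _ ⟩
  A + ∑[ u < n ] ∑[ v < n ] a v u                 ≡⟨ cong (A +_) (∑-comm (λ u v → a v u)) ⟩
  A + A                                           ≡⟨ cong (A +_) (+-identityʳ A) ⟨
  2 * A                                           ∎
  where
  open ≤-Reasoning
  a : Fin n → Fin n → ℕ
  a u v = 𝟙 ((u Finₚ.<? v) ×-dec R? u v)
  A = ∑[ u < n ] ∑[ v < n ] a u v
  split : ∀ u v → 𝟙 (R? u v) ≤ a u v + a v u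
  split u v with Finₚ.<-cmp u v
  ... | B.tri< u<v _ _ = ≤-trans (𝟙-mono (R? u v) ((u Finₚ.<? v) ×-dec R? u v) (u<v ,_)) (m≤m+n _ _)
  ... | B.tri> _ _ v<u = ≤-trans (𝟙-mono (R? u v) ((v Finₚ.<? u) ×-dec R? v u) (λ uv → v<u , R-sym uv)) (m≤n+m _ _)
  ... | B.tri≈ _ refl _ = ≤-trans (≤-reflexive (𝟙-false (R? u u) R-irrefl)) z≤n

length-filter-tabulate : ∀ {A : Set} {P : Pred A 0ℓ} (P? : Decidable P) {n} (g : Fin n → A) →
  length (filter P? (List.tabulate g)) ≡ ∑[ i < n ] 𝟙 (P? (g i))
length-filter-tabulate P? {zero}  g = refl
length-filter-tabulate P? {suc n} g with does (P? (g zero))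
... | true  = cong suc (length-filter-tabulate P? (g ∘ suc))
... | false = length-filter-tabulate P? (g ∘ suc)

-- This unfolds the list count in `e`. Tabulations of arbitrary functions, instead of `allFin`, are
-- what survives the induction.
length-filter-cartesianProduct : ∀ {A B : Set} {P : Pred (A × B) 0ℓ} (P? : Decidable P)
  {m n} (g : Fin m → A) (h : Fin n → B) →
  length (filter P? (cartesianProduct (List.tabulate g) (List.tabulate h))) ≡
  ∑[ i < m ] ∑[ j < n ] 𝟙 (P? (g i , h j))
length-filter-cartesianProduct P? {zero}  g h = refl
length-filter-cartesianProduct P? {suc m} {n} g h = begin
  length (filter P? (row List.++ rows))                  ≡⟨ cong length (Listₚ.filter-++ P? row rows) ⟩
  length (filter P? row List.++ filter P? rows)          ≡⟨ Listₚ.length-++ (filter P? row) ⟩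
  length (filter P? row) + length (filter P? rows)       ≡⟨ cong₂ _+_
    (trans (cong (length ∘ filter P?) (Listₚ.map-tabulate h (g zero ,_)))
           (length-filter-tabulate P? (λ j → g zero , h j)))
    (length-filter-cartesianProduct P? (g ∘ suc) h) ⟩
  ∑[ i < suc m ] ∑[ j < n ] 𝟙 (P? (g i , h j))           ∎
  where
  open ≡-Reasoning
  row  = List.map (g zero ,_) (List.tabulate h)
  rows = cartesianProduct (List.tabulate (g ∘ suc)) (List.tabulate h)

handshake : ∀ G → sum (degree G) ≤ 2 * e G
handshake G = ≤-trans (sum-symmetric adj? adj-sym irrefl)
  (≤-reflexive (cong (2 *_) (sym (length-filter-cartesianProduct
    (λ (u , v) → (u Finₚ.<? v) ×-dec adj? u v) id id))))
  where open Graph G hiding (V)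

module _ (G : Graph) where
  open Graph G hiding (V)

  private
    touched? : Decidable (λ v → 1 ≤ degree G v)
    touched? v = 1 ≤? degree G v

    open Enumeration (enumerate touched?)

    adj⇒touched : ∀ {u v} → Adj u v → 1 ≤ degree G u
    adj⇒touched {u} {v} uv = ≤-trans (≤-reflexive (sym (𝟙-true (adj? u v) uv)))
                                     (term≤sum (λ v → 𝟙 (adj? u v)) v)

    core : Graph
    core = induced G touched?

    core-colouring : ∀ {t} .{{_ : NonZero t}} → Colourable core t → Colourable G t
    core-colouring {suc t} (c , c-proper) = colour , proper
      where
      colour : V G → Fin (suc t)
      colour v with touched? v
      ... | yes tv = c (proj₁ (complete tv))
      -- Isolated vertices may take any colour; `NonZero t` provides one.
      ... | no  _  = zero
      proper : ∀ u v → Adj u v → colour u ≢ colour v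
      proper u v uv with touched? u | touched? v
      ... | no ¬tu | _      = contradiction (adj⇒touched uv) ¬tu
      ... | yes _  | no ¬tv = contradiction (adj⇒touched (adj-sym uv)) ¬tv
      ... | yes tu | yes tv = c-proper _ _
        (subst₂ Adj (sym (proj₂ (complete tu))) (sym (proj₂ (complete tv))) uv)

  -- Only isolated vertices prevent a bound on the order by the edges. Every other vertex adds at
  -- least one to the degree sum, so at most `2 * e G` vertices remain; the same number is a crude
  -- degree bound.
  drop-isolated : ∀ {t} .{{_ : NonZero t}} → ¬ Colourable G t →
    ∃[ G′ ] ∃[ d ] (G′ ⊑ G × MaxDegree G′ d × ¬ Colourable G′ t ×
                    Graph.order G′ * d ≤ (2 * e G) * (2 * e G))
  drop-isolated ¬col = core , 2 * e G , induced⊑ G touched? ,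
    (λ j → ≤-trans (sum-injective injective (λ v → 𝟙 (adj? (element j) v)))
             (≤-trans (term≤sum (degree G) (element j)) (handshake G))) ,
    ¬col ∘ core-colouring ,
    *-monoˡ-≤ (2 * e G) (≤-trans (order-induced G touched? (degree G) id) (handshake G))

-- Cycles and edge labels

isCycle? : ∀ H {ℓ} (v : Fin ℓ → V H) → Dec (IsCycle H v)
isCycle? H {ℓ} v = (3 ≤? ℓ) ×-dec
  map′ (λ h {i} {j} → h i j) (λ h i j → h {i} {j})
    (Finₚ.all? λ i → Finₚ.all? λ j → (v i ≟ᶠ v j) →-dec (i ≟ᶠ j)) ×-dec
  Finₚ.all? λ i → Finₚ.all? λ j →
    ((toℕ j ≟ suc (toℕ i)) ⊎-dec ((suc (toℕ i) ≟ ℓ) ×-dec (toℕ j ≟ 0)))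
    →-dec Graph.adj? H (v i) (v j)

isCycle-resp-≗ : ∀ H {ℓ} {v w : Fin ℓ → V H} → v ≗ w → IsCycle H v → IsCycle H w
isCycle-resp-≗ H v≗w (3≤ℓ , inj , adj) = 3≤ℓ ,
  (λ {i} {j} eq → inj (trans (v≗w i) (trans eq (sym (v≗w j))))) ,
  λ i j i→j → subst₂ (Graph.Adj H) (v≗w i) (v≗w j) (adj i j i→j)

next : ∀ {m} → Fin (suc m) → Fin (suc m)
next {m} i with m ≟ toℕ i
... | yes _   = zero
... | no  m≢i = suc (lower₁ i m≢i)

Next-next : ∀ {m} (i : Fin (suc m)) → Next i (next i)
Next-next {m} i with m ≟ toℕ i
... | yes m≡i = inj₂ (cong suc (sym m≡i) , refl)
... | no  m≢i = inj₁ (cong suc (Finₚ.toℕ-lower₁ i m≢i))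

-- Returning after two steps needs length at most two. Hence a cycle never runs through an edge in
-- both directions.
Next-asym : ∀ {ℓ} → 3 ≤ ℓ → {i j : Fin ℓ} → Next i j → ¬ Next j i
Next-asym 3≤ℓ (inj₁ p) (inj₁ q) = <-irrefl (trans p (cong suc q)) (s≤s (n≤1+n _))
Next-asym 3≤ℓ (inj₁ p) (inj₂ (q , r)) = <-irrefl (sym (trans (sym q) (cong suc (trans p (cong suc r))))) 3≤ℓ
Next-asym 3≤ℓ (inj₂ (p , r)) (inj₁ q) = <-irrefl (sym (trans (sym p) (cong suc (trans q (cong suc r))))) 3≤ℓ
Next-asym 3≤ℓ (inj₂ (p , r)) (inj₂ (_ , s)) = <-irrefl (sym (trans (sym p) (cong suc s))) (≤-trans (n≤1+n 2) 3≤ℓ)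

-- Both orientations of an edge share one position, with the smaller endpoint first, so that keeping
-- an edge is a symmetric decision.
edgeIndex : ∀ {n} → Fin n → Fin n → Fin (n * n)
edgeIndex u v = if does (u Finₚ.<? v) then combine u v else combine v u

edgeIndex-< : ∀ {n} {u v : Fin n} → toℕ u < toℕ v → edgeIndex u v ≡ combine u v
edgeIndex-< {u = u} {v} u<v =
  cong (λ c → if c then combine u v else combine v u) (dec-true (u Finₚ.<? v) u<v)

edgeIndex-≮ : ∀ {n} {u v : Fin n} → ¬ toℕ u < toℕ v → edgeIndex u v ≡ combine v u
edgeIndex-≮ {u = u} {v} u≮v =
  cong (λ c → if c then combine u v else combine v u) (dec-false (u Finₚ.<? v) u≮v)

edgeIndex-sym : ∀ {n} (u v : Fin n) → edgeIndex u v ≡ edgeIndex v u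
edgeIndex-sym u v with Finₚ.<-cmp u v
... | B.tri< u<v _ v≮u  = trans (edgeIndex-< u<v) (sym (edgeIndex-≮ v≮u))
... | B.tri≈ _ refl _   = refl
... | B.tri> u≮v _ v<u  = trans (edgeIndex-≮ u≮v) (sym (edgeIndex-< v<u))

edgeIndex-injective : ∀ {n} (u v w x : Fin n) → edgeIndex u v ≡ edgeIndex w x →
                      (u ≡ w × v ≡ x) ⊎ (u ≡ x × v ≡ w)
edgeIndex-injective u v w x eq with u Finₚ.<? v | w Finₚ.<? x
... | yes u<v | yes w<x = inj₁ (Finₚ.combine-injective u v w x
  (trans (sym (edgeIndex-< u<v)) (trans eq (edgeIndex-< w<x))))
... | yes u<v | no  w≮x = inj₂ (Finₚ.combine-injective u v x w
  (trans (sym (edgeIndex-< u<v)) (trans eq (edgeIndex-≮ w≮x))))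
... | no  u≮v | yes w<x =
  let v≡w , u≡x = Finₚ.combine-injective v u w x (trans (sym (edgeIndex-≮ u≮v)) (trans eq (edgeIndex-< w<x)))
  in inj₂ (u≡x , v≡w)
... | no  u≮v | no  w≮x =
  let v≡x , u≡w = Finₚ.combine-injective v u x w (trans (sym (edgeIndex-≮ u≮v)) (trans eq (edgeIndex-≮ w≮x)))
  in inj₁ (u≡w , v≡x)

-- After `u` and `v` are exchanged in the second summand, the coefficient of `g u v` is a sum of two
-- mutually exclusive indicators.
sum-ordered-pairs : ∀ {n} (g : Fin n → Fin n → ℕ) →
  ∑[ u < n ] ∑[ v < n ] (𝟙 (u Finₚ.<? v) * (g u v + g v u)) ≤ ∑[ u < n ] ∑[ v < n ] g u v
sum-ordered-pairs {n} g = begin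
  ∑[ u < n ] ∑[ v < n ] (𝟙 (u Finₚ.<? v) * (g u v + g v u))
    ≡⟨ (sum-cong-≗ λ u → trans (sum-cong-≗ λ v → *-distribˡ-+ (𝟙 (u Finₚ.<? v)) (g u v) (g v u))
                               (∑-distrib-+ (a u) (b u))) ⟩
  ∑[ u < n ] (∑[ v < n ] a u v + ∑[ v < n ] b u v)
    ≡⟨ ∑-distrib-+ (λ u → ∑[ v < n ] a u v) (λ u → ∑[ v < n ] b u v) ⟩
  ∑[ u < n ] ∑[ v < n ] a u v + ∑[ u < n ] ∑[ v < n ] b u v
    ≡⟨ cong (∑[ u < n ] ∑[ v < n ] a u v +_) (∑-comm b) ⟩
  ∑[ u < n ] ∑[ v < n ] a u v + ∑[ u < n ] ∑[ v < n ] b v u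
    ≡⟨ ∑-distrib-+ (λ u → ∑[ v < n ] a u v) (λ u → ∑[ v < n ] b v u) ⟨
  ∑[ u < n ] (∑[ v < n ] a u v + ∑[ v < n ] b v u)
    ≡⟨ (sum-cong-≗ λ u → ∑-distrib-+ (a u) (λ v → b v u)) ⟨
  ∑[ u < n ] ∑[ v < n ] (a u v + b v u)
    ≤⟨ sum-mono (λ u → sum-mono (once u)) ⟩
  ∑[ u < n ] ∑[ v < n ] g u v ∎
  where
  open ≤-Reasoning
  a b : Fin n → Fin n → ℕ
  a u v = 𝟙 (u Finₚ.<? v) * g u v
  b u v = 𝟙 (u Finₚ.<? v) * g v u
  once : ∀ u v → a u v + b v u ≤ g u v
  once u v = begin
    a u v + b v u                                  ≡⟨ *-distribʳ-+ (g u v) (𝟙 (u Finₚ.<? v)) (𝟙 (v Finₚ.<? u)) ⟨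
    (𝟙 (u Finₚ.<? v) + 𝟙 (v Finₚ.<? u)) * g u v    ≤⟨ *-monoˡ-≤ (g u v) (𝟙-exclusive (u Finₚ.<? v) (v Finₚ.<? u) <-asym) ⟩
    1 * g u v                                      ≡⟨ *-identityˡ (g u v) ⟩
    g u v                                          ∎

-- Exponential estimates

-- Bernoulli's inequality for the `m`-th power of 1 + 1/y, multiplied by `y ^ suc m`.
bernoulli : ∀ y m → (y + m) * y ^ m ≤ y * suc y ^ m
bernoulli y zero    = ≤-reflexive (cong (_* 1) (+-identityʳ y))
bernoulli y (suc m) = begin
  -- The added term completes `(y + suc m) * y + m` to `suc y * (y + m)`.
  (y + suc m) * (y * y ^ m)             ≤⟨ m≤m+n _ (m * y ^ m) ⟩
  (y + suc m) * (y * y ^ m) + m * y ^ m ≡⟨ expand y m (y ^ m) ⟩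
  suc y * ((y + m) * y ^ m)             ≤⟨ *-monoʳ-≤ (suc y) (bernoulli y m) ⟩
  suc y * (y * suc y ^ m)               ≡⟨ x∙yz≈y∙xz (suc y) y (suc y ^ m) ⟩
  y * (suc y * suc y ^ m)               ∎
  where
  open ≤-Reasoning
  expand : ∀ y m p → (y + suc m) * (y * p) + m * p ≡ suc y * ((y + m) * p)
  expand = solve-∀

2*y^y≤[1+y]^y : ∀ y .{{_ : NonZero y}} → 2 * y ^ y ≤ suc y ^ y
2*y^y≤[1+y]^y y = *-cancelˡ-≤ y (begin
  y * (2 * y ^ y)   ≡⟨ double y (y ^ y) ⟩
  (y + y) * y ^ y   ≤⟨ bernoulli y y ⟩
  y * suc y ^ y     ∎)
  where
  open ≤-Reasoning
  double : ∀ y p → y * (2 * p) ≡ (y + y) * p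
  double = solve-∀

^-distribʳ-* : ∀ a b p → (a * b) ^ p ≡ a ^ p * b ^ p
^-distribʳ-* a b zero    = refl
^-distribʳ-* a b (suc p) = trans (cong (a * b *_) (^-distribʳ-* a b p)) (interchange a b (a ^ p) (b ^ p))

-- Every block of `y` factors 1 + 1/y at least doubles, and `m` contains `p` such blocks; the
-- remaining factors are at least one.
^-growth : ∀ y .{{_ : NonZero y}} p {m} → y * p ≤ m → 2 ^ p * y ^ m ≤ suc y ^ m
^-growth y p yp≤m with o , refl ← m≤n⇒∃[o]m+o≡n yp≤m = begin
  2 ^ p * y ^ (y * p + o)             ≡⟨ cong (2 ^ p *_) (^-distribˡ-+-* y (y * p) o) ⟩
  2 ^ p * (y ^ (y * p) * y ^ o)       ≡⟨ cong (λ x → 2 ^ p * (x * y ^ o)) (^-*-assoc y y p) ⟨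
  2 ^ p * ((y ^ y) ^ p * y ^ o)       ≡⟨ *-assoc (2 ^ p) _ _ ⟨
  2 ^ p * (y ^ y) ^ p * y ^ o         ≡⟨ cong (_* y ^ o) (^-distribʳ-* 2 (y ^ y) p) ⟨
  (2 * y ^ y) ^ p * y ^ o             ≤⟨ *-mono-≤ (^-monoˡ-≤ p (2*y^y≤[1+y]^y y)) (^-monoˡ-≤ o (n≤1+n y)) ⟩
  (suc y ^ y) ^ p * suc y ^ o         ≡⟨ cong (_* suc y ^ o) (^-*-assoc (suc y) y p) ⟩
  suc y ^ (y * p) * suc y ^ o         ≡⟨ ^-distribˡ-+-* (suc y) (y * p) o ⟨
  suc y ^ (y * p + o)                 ∎
  where open ≤-Reasoning

n<2^n : ∀ n → n < 2 ^ n
n<2^n zero    = ≤-refl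
n<2^n (suc n) = +-mono-≤ {1} (m^n>0 2 n) (≤-trans (n<2^n n) (m≤m+n (2 ^ n) 0))

-- Random sparsification

isOn : ∀ {b} → Fin (suc b) → Bool
isOn zero    = true
isOn (suc _) = false

module Sparsification (G : Graph) (b r k : ℕ) where
  open Graph G hiding (V)

  n N D y : ℕ
  n = order
  N = n * n
  D = suc b
  -- The letter sum of a `penalty` factor at a monochromatic edge: `1` for the letter zero and `2`
  -- for each of the `b` others. At other positions it is `2 * D`, which is `suc y`.
  y = suc (b * 2)

  -- An edge is kept when its letter is zero.  Under the uniform distribution
  -- on Ω this has probability 1 / D, and sumVec N is D ^ N times the expectation.
  Ω : Set
  Ω = Vec (Fin D) N

  Kept : Ω → Rel (V G) 0ℓ
  Kept ω u v = Adj u v × lookup ω (edgeIndex u v) ≡ zero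

  kept : Ω → Graph
  kept ω = record
    { order   = order
    ; Adj     = Kept ω
    ; adj?    = λ u v → adj? u v ×-dec (lookup ω (edgeIndex u v) ≟ᶠ zero)
    ; adj-sym = λ {u} {v} (uv , on) → adj-sym uv , trans (cong (lookup ω) (edgeIndex-sym v u)) on
    ; irrefl  = irrefl ∘ proj₁
    }

  -- The i-th summand is for the cycle length 2 + i.
  cyclesFrom : Ω → V G → V G → ℕ
  cyclesFrom ω x y = ∑[ i < r ] sumVec (toℕ i) λ w → 𝟙 (isCycle? (kept ω) (lookup (x ∷ y ∷ w)))

  cycles : Ω → ℕ
  cycles ω = ∑[ x < n ] ∑[ y < n ] cyclesFrom ω x y

  -- A short cycle is destroyed by deleting its first edge.
  thinned : Ω → Graph
  thinned ω = record
    { order   = order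
    ; Adj     = λ u v → Kept ω u v × cyclesFrom ω u v ≡ 0 × cyclesFrom ω v u ≡ 0
    ; adj?    = λ u v → Graph.adj? (kept ω) u v ×-dec (cyclesFrom ω u v ≟ 0) ×-dec (cyclesFrom ω v u ≟ 0)
    ; adj-sym = λ (uv , cuv , cvu) → Graph.adj-sym (kept ω) uv , cvu , cuv
    ; irrefl  = irrefl ∘ proj₁ ∘ proj₁
    }

  thinned⊑ : ∀ ω → thinned ω ⊑ G
  thinned⊑ ω = id , id , proj₁ ∘ proj₁

  -- A length `2 + l` with `r ≤ l` is long enough anyway. Otherwise the cycle is also one of
  -- `kept ω`, so `cyclesFrom` is positive at its first edge, which is therefore absent from
  -- `thinned ω`.
  thinned-no-short-cycle : ∀ ω ℓ → HasCycle (thinned ω) ℓ → r ≤ ℓ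
  thinned-no-short-cycle ω (suc (suc l)) cyc with r ≤? l
  ... | yes r≤l = ≤-trans r≤l (m≤n+m l 2)
  ... | no  r≰l = contradiction cyc (short (fromℕ< (≰⇒> r≰l)) (sym (Finₚ.toℕ-fromℕ< (≰⇒> r≰l))))
    where
    short : ∀ {l} (i : Fin r) → l ≡ toℕ i → ¬ HasCycle (thinned ω) (suc (suc l))
    short i refl (v , 3≤ℓ , inj , adj) = <-irrefl
      (sym (proj₁ (proj₂ (adj zero (suc zero) (inj₁ refl)))))
      (begin
        1 ≡⟨ 𝟙-true (isCycle? (kept ω) (lookup (v zero ∷ v (suc zero) ∷ w)))
               (isCycle-resp-≗ (kept ω) {v = v} v≗ (3≤ℓ , inj , λ i j i→j → proj₁ (adj i j i→j))) ⟨
        𝟙 (isCycle? (kept ω) (lookup (v zero ∷ v (suc zero) ∷ w)))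
          ≤⟨ term≤sumVec (λ w → 𝟙 (isCycle? (kept ω) (lookup (v zero ∷ v (suc zero) ∷ w)))) w ⟩
        sumVec (toℕ i) (λ w → 𝟙 (isCycle? (kept ω) (lookup (v zero ∷ v (suc zero) ∷ w))))
          ≤⟨ term≤sum (λ i → sumVec (toℕ i) λ w → 𝟙 (isCycle? (kept ω) (lookup (v zero ∷ v (suc zero) ∷ w)))) i ⟩
        cyclesFrom ω (v zero) (v (suc zero)) ∎)
      where
      open ≤-Reasoning
      w = tabulate (λ j → v (suc (suc j)))
      v≗ : v ≗ lookup (v zero ∷ v (suc zero) ∷ w)
      v≗ zero          = refl
      v≗ (suc zero)    = refl
      v≗ (suc (suc j)) = sym (lookup∘tabulate (λ j → v (suc (suc j))) j)
  thinned-no-short-cycle ω 0 (_ , () , _)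
  thinned-no-short-cycle ω 1 (_ , s≤s () , _)

  -- The indicator of a walk in `G`, written as a product so that summing over its vertices
  -- factorises step by step.
  chain : ∀ {l} → V G → Vec (V G) l → ℕ
  chain x []      = 1
  chain x (y ∷ w) = 𝟙 (adj? x y) * chain y w

  sum-chain : ∀ {d} → MaxDegree G d → ∀ l x → sumVec l (chain x) ≤ d ^ l
  sum-chain     Δ≤d zero    x = ≤-refl
  sum-chain {d} Δ≤d (suc l) x = begin
    ∑[ y < n ] sumVec l (λ w → 𝟙 (adj? x y) * chain y w)
      ≡⟨ (sum-cong-≗ λ y → sumVec-*ˡ l (𝟙 (adj? x y)) (chain y)) ⟩
    ∑[ y < n ] (𝟙 (adj? x y) * sumVec l (chain y))
      ≤⟨ sum-mono (λ y → *-monoʳ-≤ (𝟙 (adj? x y)) (sum-chain Δ≤d l y)) ⟩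
    ∑[ y < n ] (𝟙 (adj? x y) * d ^ l)
      ≡⟨ *-distribʳ-sum (d ^ l) (λ y → 𝟙 (adj? x y)) ⟨
    degree G x * d ^ l
      ≤⟨ *-monoˡ-≤ (d ^ l) (Δ≤d x) ⟩
    d ^ suc l ∎
    where open ≤-Reasoning

  1≤chain : ∀ {l} x (w : Vec (V G) l) →
            (∀ i → Adj (lookup (x ∷ w) (inject₁ i)) (lookup w i)) → 1 ≤ chain x w
  1≤chain x []      adj = ≤-refl
  1≤chain x (y ∷ w) adj = *-mono-≤ {1} {_} {1}
    (≤-reflexive (sym (𝟙-true (adj? x y) (adj zero)))) (1≤chain y w (adj ∘ suc))

  isCycle⇒1≤chain : ∀ {l} x (w : Vec (V G) l) → IsCycle G (lookup (x ∷ w)) → 1 ≤ chain x w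
  isCycle⇒1≤chain x w (_ , _ , adj) =
    1≤chain x w λ i → adj (inject₁ i) (suc i) (inj₁ (cong suc (sym (Finₚ.toℕ-inject₁ i))))

  -- A fixed cycle survives with probability at most one in `D ^ suc m`: its edges occupy distinct
  -- positions, all of which must carry the letter zero, and the letters are independent.
  sum-isCycle : ∀ {m} (v : Fin (suc m) → V G) → IsCycle G v →
    sumVec N (λ ω → 𝟙 (isCycle? (kept ω) v)) * D ^ suc m ≤ D ^ N
  sum-isCycle {m} v (3≤ℓ , v-inj , adj) = begin
    sumVec N (λ ω → 𝟙 (isCycle? (kept ω) v)) * D ^ suc m   ≤⟨ *-monoˡ-≤ (D ^ suc m) (sumVec-mono N 𝟙≤product) ⟩
    sumVec N (λ ω → product (λ i → factor i (lookup ω i))) * D ^ suc m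
      ≡⟨ cong (_* D ^ suc m) (trans (sumVec-product N factor) (product-cong λ i → sum-factor (S i))) ⟩
    product (λ i → if S i then 1 else D) * D ^ suc m       ≤⟨ *-monoʳ-≤ (product λ i → if S i then 1 else D) (^-monoʳ-≤ D ℓ≤#S) ⟩
    product (λ i → if S i then 1 else D) * D ^ (∑[ i < N ] ⟦ S i ⟧) ≡⟨ product-two-valued S 1 D ⟩
    1 ^ (∑[ i < N ] ⟦ S i ⟧) * D ^ N                       ≡⟨ cong (_* D ^ N) (^-zeroˡ (∑[ i < N ] ⟦ S i ⟧)) ⟩
    1 * D ^ N                                              ≡⟨ *-identityˡ (D ^ N) ⟩
    D ^ N                                                  ∎
    where
    open ≤-Reasoning
    edge : Fin (suc m) → Fin N
    edge j = edgeIndex (v j) (v (next j))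

    edge-injective : Injective _≡_ _≡_ edge
    edge-injective {i} {j} eq with edgeIndex-injective (v i) _ (v j) _ eq
    ... | inj₁ (vi≡vj , _) = v-inj vi≡vj
    -- Two cycle edges that agree with opposite orientations would make `Next` hold in both
    -- directions.
    ... | inj₂ (p , q) with refl ← v-inj p = contradiction
      (subst (Next (next j)) (v-inj q) (Next-next (next j)))
      (Next-asym 3≤ℓ (Next-next j))

    onEdge? : Decidable (λ i → ∃[ j ] edge j ≡ i)
    onEdge? i = Finₚ.any? λ j → edge j ≟ᶠ i

    S : Fin N → Bool
    S i = does (onEdge? i)

    -- Summed over the letters this gives `1` on the cycle and `D` off it.
    factor : Fin N → Fin D → ℕ
    factor i x = if S i then ⟦ isOn x ⟧ else 1

    sum-factor : ∀ s → ∑[ x < D ] (if s then ⟦ isOn x ⟧ else 1) ≡ (if s then 1 else D)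
    sum-factor true  = cong suc (trans (sum-const b 0) (*-zeroʳ b))
    sum-factor false = trans (sum-const D 1) (*-identityʳ D)

    ℓ≤#S : suc m ≤ ∑[ i < N ] ⟦ S i ⟧
    ℓ≤#S = begin
      suc m                         ≡⟨ trans (sum-const (suc m) 1) (*-identityʳ (suc m)) ⟨
      ∑[ j < suc m ] 1              ≡⟨ (sum-cong-≗ λ j → 𝟙-true (onEdge? (edge j)) (j , refl)) ⟨
      ∑[ j < suc m ] ⟦ S (edge j) ⟧ ≤⟨ sum-injective edge-injective (λ i → ⟦ S i ⟧) ⟩
      ∑[ i < N ] ⟦ S i ⟧            ∎

    𝟙≤product : ∀ ω → 𝟙 (isCycle? (kept ω) v) ≤ product (λ i → factor i (lookup ω i))
    𝟙≤product ω = 𝟙-≤ (isCycle? (kept ω) v) λ (_ , _ , kept-adj) →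
      ≤-reflexive (sym (product-one (λ i → factor i (lookup ω i)) λ i →
        if-does (onEdge? i)
          (λ { (j , refl) → cong (⟦_⟧ ∘ isOn) (proj₂ (kept-adj j (next j) (Next-next j))) })
          refl))

  -- A tuple that is no cycle of `G` never becomes one, and a cycle is a walk. The closing edge is
  -- absent from `chain` but counted in the power of `D`; this surplus factor `D` is what makes
  -- short cycles rare.
  sum-isCycle≤chain : ∀ {l} x (w : Vec (V G) l) →
    sumVec N (λ ω → 𝟙 (isCycle? (kept ω) (lookup (x ∷ w)))) * D ^ suc l ≤ chain x w * D ^ N
  sum-isCycle≤chain {l} x w with isCycle? G (lookup (x ∷ w))
  ... | yes cyc = ≤-trans (sum-isCycle (lookup (x ∷ w)) cyc)
    (≤-trans (≤-reflexive (sym (*-identityˡ (D ^ N)))) (*-monoˡ-≤ (D ^ N) (isCycle⇒1≤chain x w cyc)))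
  ... | no ¬cyc = ≤-trans (≤-reflexive (cong (_* D ^ suc l)
    (trans (sumVec-cong N λ ω → 𝟙-false (isCycle? (kept ω) (lookup (x ∷ w)))
              λ (3≤ℓ , inj , adj) → ¬cyc (3≤ℓ , inj , λ i j i→j → proj₁ (adj i j i→j)))
           (trans (sumVec-const {D} N 0) (*-zeroʳ (D ^ N)))))) z≤n

  -- At most `n * d ^ suc l` walks can become cycles of length `2 + l`, each with probability at
  -- most one in `D ^ suc (suc l)`. By `sparse` each of the `r` lengths contributes at most `n`
  -- divided by `2 * r`.
  sum-cycles : ∀ {d} .{{_ : NonZero r}} → MaxDegree G d →
    (∀ l → l < r → 2 * r * d ^ suc l ≤ D ^ suc (suc l)) →
    2 * sumVec N cycles ≤ n * D ^ N
  sum-cycles {d} Δ≤d sparse = *-cancelˡ-≤ r (begin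
    r * (2 * sumVec N cycles)        ≡⟨ x∙yz≈yx∙z r 2 (sumVec N cycles) ⟩
    2 * r * sumVec N cycles          ≡⟨ cong (2 * r *_) by-length ⟩
    2 * r * ∑[ i < r ] C i           ≡⟨ *-distribˡ-sum (2 * r) C ⟩
    ∑[ i < r ] (2 * r * C i)         ≤⟨ sum-bounded bound ⟩
    r * (n * D ^ N)                  ∎)
    where
    open ≤-Reasoning

    T : V G → V G → Fin r → ℕ
    T x y i = sumVec N λ ω → sumVec (toℕ i) λ w → 𝟙 (isCycle? (kept ω) (lookup (x ∷ y ∷ w)))

    C : Fin r → ℕ
    C i = ∑[ x < n ] ∑[ y < n ] T x y i

    by-length : sumVec N cycles ≡ ∑[ i < r ] C i
    by-length = begin-equality
      sumVec N cycles
        ≡⟨ sumVec-sum N {n} (λ x ω → ∑[ y < n ] cyclesFrom ω x y) ⟩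
      ∑[ x < n ] sumVec N (λ ω → ∑[ y < n ] cyclesFrom ω x y)
        ≡⟨ (sum-cong-≗ λ x → trans (sumVec-sum N {n} (λ y ω → cyclesFrom ω x y))
             (trans (sum-cong-≗ λ y → sumVec-sum N {r} (λ i ω → sumVec (toℕ i) λ w → 𝟙 (isCycle? (kept ω) (lookup (x ∷ y ∷ w)))))
                    (∑-comm {n} {r} (T x)))) ⟩
      ∑[ x < n ] ∑[ i < r ] ∑[ y < n ] T x y i
        ≡⟨ ∑-comm {n} {r} (λ x i → ∑[ y < n ] T x y i) ⟩
      ∑[ i < r ] C i ∎

    T-bound : ∀ x y i → T x y i * D ^ suc (suc (toℕ i)) ≤ sumVec (toℕ i) (λ w → chain x (y ∷ w)) * D ^ N
    T-bound x y i = begin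
      T x y i * P
        ≡⟨ cong (_* P) (sumVec-comm N (toℕ i) (λ ω w → 𝟙 (isCycle? (kept ω) (lookup (x ∷ y ∷ w))))) ⟩
      sumVec (toℕ i) (λ w → E w) * P
        ≡⟨ trans (*-comm (sumVec (toℕ i) E) P) (sym (sumVec-*ˡ (toℕ i) P E)) ⟩
      sumVec (toℕ i) (λ w → P * E w)
        ≤⟨ sumVec-mono (toℕ i) (λ w → ≤-trans (≤-reflexive (*-comm P (E w)))
             (≤-trans (sum-isCycle≤chain x (y ∷ w)) (≤-reflexive (*-comm (chain x (y ∷ w)) (D ^ N))))) ⟩
      sumVec (toℕ i) (λ w → D ^ N * chain x (y ∷ w))
        ≡⟨ trans (sumVec-*ˡ (toℕ i) (D ^ N) (λ w → chain x (y ∷ w))) (*-comm (D ^ N) _) ⟩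
      sumVec (toℕ i) (λ w → chain x (y ∷ w)) * D ^ N ∎
      where
      P = D ^ suc (suc (toℕ i))
      E : Vec (V G) (toℕ i) → ℕ
      E w = sumVec N λ ω → 𝟙 (isCycle? (kept ω) (lookup (x ∷ y ∷ w)))

    C-bound : ∀ i → C i * D ^ suc (suc (toℕ i)) ≤ n * d ^ suc (toℕ i) * D ^ N
    C-bound i = begin
      C i * P                                      ≡⟨ *-distribʳ-sum P (λ x → ∑[ y < n ] T x y i) ⟩
      ∑[ x < n ] (∑[ y < n ] T x y i * P)          ≤⟨ sum-bounded row ⟩
      n * (d ^ suc (toℕ i) * D ^ N)                ≡⟨ *-assoc n _ _ ⟨
      n * d ^ suc (toℕ i) * D ^ N                  ∎
      where
      P = D ^ suc (suc (toℕ i))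
      row : ∀ x → ∑[ y < n ] T x y i * P ≤ d ^ suc (toℕ i) * D ^ N
      row x = begin
        ∑[ y < n ] T x y i * P                    ≡⟨ *-distribʳ-sum P (λ y → T x y i) ⟩
        ∑[ y < n ] (T x y i * P)                  ≤⟨ sum-mono (λ y → T-bound x y i) ⟩
        ∑[ y < n ] (sumVec (toℕ i) (λ w → chain x (y ∷ w)) * D ^ N)
          ≡⟨ *-distribʳ-sum (D ^ N) (λ y → sumVec (toℕ i) (λ w → chain x (y ∷ w))) ⟨
        sumVec (suc (toℕ i)) (chain x) * D ^ N    ≤⟨ *-monoˡ-≤ (D ^ N) (sum-chain Δ≤d (suc (toℕ i)) x) ⟩
        d ^ suc (toℕ i) * D ^ N                   ∎

    bound : ∀ i → 2 * r * C i ≤ n * D ^ N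
    bound i = *-cancelʳ-≤ (2 * r * C i) (n * D ^ N) P {{m^n≢0 D (suc (suc (toℕ i)))}} (begin
      2 * r * C i * P                            ≡⟨ *-assoc (2 * r) (C i) P ⟩
      2 * r * (C i * P)                          ≤⟨ *-monoʳ-≤ (2 * r) (C-bound i) ⟩
      2 * r * (n * d ^ suc (toℕ i) * D ^ N)      ≡⟨ regroup (2 * r) n (d ^ suc (toℕ i)) (D ^ N) ⟩
      2 * r * d ^ suc (toℕ i) * (n * D ^ N)      ≤⟨ *-monoˡ-≤ (n * D ^ N) (sparse (toℕ i) (Finₚ.toℕ<n i)) ⟩
      P * (n * D ^ N)                            ≡⟨ *-comm P (n * D ^ N) ⟩
      n * D ^ N * P                              ∎)
      where
      P = D ^ suc (suc (toℕ i))
      regroup : ∀ a b c e → a * (b * c * e) ≡ a * c * (b * e)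
      regroup = solve-∀

  monoEdge? : (c : V G → Fin k) → Decidable (λ ((u , v) : V G × V G) → toℕ u < toℕ v × Adj u v × c u ≡ c v)
  monoEdge? c (u , v) = (u Finₚ.<? v) ×-dec adj? u v ×-dec c u ≟ᶠ c v

  monoEdges : (V G → Fin k) → ℕ
  monoEdges c = ∑[ u < n ] ∑[ v < n ] 𝟙 (monoEdge? c (u , v))

  isMono : (V G → Fin k) → Fin N → Bool
  isMono c i = does (monoEdge? c (remQuot n i))

  survivors : (V G → Fin k) → Ω → ℕ
  survivors c ω = ∑[ i < N ] ⟦ isMono c i ∧ isOn (lookup ω i) ⟧

  -- Equal to 2 ^ (N - survivors); its average over Ω factorises, which bounds
  -- the probability of few survivors.
  penalty : (V G → Fin k) → Ω → ℕ
  penalty c ω = product (λ i → if isMono c i ∧ isOn (lookup ω i) then 1 else 2)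

  penalty*2^survivors : ∀ c ω → penalty c ω * 2 ^ survivors c ω ≡ 2 ^ N
  penalty*2^survivors c ω = begin
    penalty c ω * 2 ^ survivors c ω  ≡⟨ product-two-valued (λ i → isMono c i ∧ isOn (lookup ω i)) 1 2 ⟩
    1 ^ survivors c ω * 2 ^ N        ≡⟨ cong (_* 2 ^ N) (^-zeroˡ (survivors c ω)) ⟩
    1 * 2 ^ N                        ≡⟨ *-identityˡ (2 ^ N) ⟩
    2 ^ N                            ∎
    where open ≡-Reasoning

  count-isMono : ∀ c → ∑[ i < N ] ⟦ isMono c i ⟧ ≡ monoEdges c
  count-isMono c = trans (sum-combine n n (λ i → ⟦ isMono c i ⟧))
    (sum-cong-≗ λ u → sum-cong-≗ λ v → cong (λ uv → 𝟙 (monoEdge? c uv)) (Finₚ.remQuot-combine u v))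

  -- The mean of 2^(-survivors) factorises into the `M`-th power of y / (y + 1), which `^-growth`
  -- bounds by 2^(-p). Multiplication by `y ^ M` clears the denominators.
  sum-penalty : ∀ c p → y * p ≤ monoEdges c → sumVec N (penalty c) * 2 ^ p ≤ suc y ^ N
  sum-penalty c p yp≤M = *-cancelʳ-≤ _ _ (y ^ M) {{m^n≢0 y M}} (begin
    W * 2 ^ p * y ^ M            ≡⟨ *-assoc W (2 ^ p) (y ^ M) ⟩
    W * (2 ^ p * y ^ M)          ≤⟨ *-monoʳ-≤ W (^-growth y p (≤-trans yp≤M (≤-reflexive (sym (count-isMono c))))) ⟩
    W * suc y ^ M                ≡⟨ cong (_* suc y ^ M) W≡ ⟩
    product (λ i → if isMono c i then y else suc y) * suc y ^ M  ≡⟨ product-two-valued (isMono c) y (suc y) ⟩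
    y ^ M * suc y ^ N            ≡⟨ *-comm (y ^ M) (suc y ^ N) ⟩
    suc y ^ N * y ^ M            ∎)
    where
    open ≤-Reasoning
    W = sumVec N (penalty c)
    M = ∑[ i < N ] ⟦ isMono c i ⟧
    sum-factor : ∀ s → ∑[ x < D ] (if s ∧ isOn x then 1 else 2) ≡ (if s then y else suc y)
    sum-factor true  = cong suc (sum-const b 2)
    sum-factor false = sum-const D 2
    W≡ : W ≡ product (λ i → if isMono c i then y else suc y)
    W≡ = trans (sumVec-product N (λ i x → if isMono c i ∧ isOn x then 1 else 2))
               (product-cong λ i → sum-factor (isMono c i))

  totalPenalty : Ω → ℕ
  totalPenalty ω = sumVec n (λ f → penalty (lookup f) ω)

  -- A union bound over the `k ^ n` colourings. The exponent `(2 * k + 2) * n` pays for `k ^ n`, for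
  -- `2 ^ n` and for the `4`, as `2 * k < 2 ^ (2 * k)` and `4 ≤ 2 ^ (2 * n)`.
  sum-totalPenalty : .{{_ : NonZero k}} → 1 ≤ n →
    (∀ c → y * ((2 * k + 2) * n) ≤ monoEdges c) →
    4 * (2 ^ n * sumVec N totalPenalty) ≤ 2 ^ N * D ^ N
  sum-totalPenalty 1≤n many = *-cancelˡ-≤ (k ^ n) {{m^n≢0 k n}} (begin
    k ^ n * (4 * (2 ^ n * A))          ≡⟨ regroup (k ^ n) (2 ^ n) A ⟩
    A * (2 ^ n * k ^ n * 4)            ≤⟨ *-monoʳ-≤ A 2^nk^n4≤ ⟩
    A * 2 ^ p                          ≡⟨ cong (_* 2 ^ p) (sumVec-comm N n (λ ω f → penalty (lookup f) ω)) ⟩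
    sumVec n E * 2 ^ p                 ≡⟨ trans (*-comm _ (2 ^ p)) (sym (sumVec-*ˡ n (2 ^ p) E)) ⟩
    sumVec n (λ f → 2 ^ p * E f)       ≤⟨ sumVec-mono n (λ f → ≤-trans (≤-reflexive (*-comm (2 ^ p) (E f)))
                                           (sum-penalty (lookup f) p (many (lookup f)))) ⟩
    sumVec n (λ _ → suc y ^ N)         ≡⟨ sumVec-const n (suc y ^ N) ⟩
    k ^ n * suc y ^ N                  ≡⟨ cong (λ z → k ^ n * z ^ N) (*-comm D 2) ⟩
    k ^ n * (2 * D) ^ N                ≡⟨ cong (k ^ n *_) (^-distribʳ-* 2 D N) ⟩
    k ^ n * (2 ^ N * D ^ N)            ∎)
    where
    open ≤-Reasoning
    A = sumVec N totalPenalty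
    p = (2 * k + 2) * n
    E : Vec (Fin k) n → ℕ
    E f = sumVec N (penalty (lookup f))
    regroup : ∀ κ τ A → κ * (4 * (τ * A)) ≡ A * (τ * κ * 4)
    regroup = solve-∀
    2^nk^n4≤ : 2 ^ n * k ^ n * 4 ≤ 2 ^ p
    2^nk^n4≤ = begin
      2 ^ n * k ^ n * 4                ≡⟨ cong (_* 4) (^-distribʳ-* 2 k n) ⟨
      (2 * k) ^ n * 2 ^ 2              ≤⟨ *-mono-≤ (^-monoˡ-≤ n (<⇒≤ (n<2^n (2 * k)))) (^-monoʳ-≤ 2 (*-monoʳ-≤ 2 1≤n)) ⟩
      (2 ^ (2 * k)) ^ n * 2 ^ (2 * n)  ≡⟨ cong (_* 2 ^ (2 * n)) (^-*-assoc 2 (2 * k) n) ⟩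
      2 ^ (2 * k * n) * 2 ^ (2 * n)    ≡⟨ ^-distribˡ-+-* 2 (2 * k * n) (2 * n) ⟨
      2 ^ (2 * k * n + 2 * n)          ≡⟨ cong (2 ^_) (*-distribʳ-+ n (2 * k) 2) ⟨
      2 ^ p                            ∎

  -- A kept edge that is monochromatic under a proper colouring of `thinned ω` must have been
  -- deleted; so it starts a short cycle in one of its orientations and is charged to that cycle.
  survivors≤cycles : ∀ ω (c : V G → Fin k) → ProperColouring (thinned ω) c → survivors c ω ≤ cycles ω
  survivors≤cycles ω c proper = begin
    survivors c ω
      ≡⟨ sum-combine n n (λ i → ⟦ isMono c i ∧ isOn (lookup ω i) ⟧) ⟩
    ∑[ u < n ] ∑[ v < n ] ⟦ isMono c (combine u v) ∧ isOn (lookup ω (combine u v)) ⟧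
      ≤⟨ sum-mono (λ u → sum-mono λ v → ≤-trans
           (≤-reflexive (cong (λ uv → ⟦ does (monoEdge? c uv) ∧ isOn (lookup ω (combine u v)) ⟧) (Finₚ.remQuot-combine u v)))
           (term u v)) ⟩
    ∑[ u < n ] ∑[ v < n ] (𝟙 (u Finₚ.<? v) * (cyclesFrom ω u v + cyclesFrom ω v u))
      ≤⟨ sum-ordered-pairs (cyclesFrom ω) ⟩
    cycles ω ∎
    where
    open ≤-Reasoning
    isOn⇒zero : ∀ (x : Fin D) → isOn x ≡ true → x ≡ zero
    isOn⇒zero zero _ = refl

    on-short-cycle : ∀ u v → toℕ u < toℕ v → Adj u v → c u ≡ c v → lookup ω (combine u v) ≡ zero →
                     1 ≤ cyclesFrom ω u v + cyclesFrom ω v u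
    on-short-cycle u v u<v uv cu≡cv on with cyclesFrom ω u v + cyclesFrom ω v u in eq
    ... | suc _ = s≤s z≤n
    ... | zero  = contradiction cu≡cv (proper u v
      ((uv , trans (cong (lookup ω) (edgeIndex-< u<v)) on) ,
       m+n≡0⇒m≡0 _ eq , m+n≡0⇒n≡0 (cyclesFrom ω u v) eq))

    term : ∀ u v → ⟦ does (monoEdge? c (u , v)) ∧ isOn (lookup ω (combine u v)) ⟧ ≤
                   𝟙 (u Finₚ.<? v) * (cyclesFrom ω u v + cyclesFrom ω v u)
    term u v = 𝟙∧-≤ (monoEdge? c (u , v)) λ (u<v , uv , cu≡cv) on →
      *-mono-≤ {1} {_} {1} (≤-reflexive (sym (𝟙-true (u Finₚ.<? v) u<v)))
        (on-short-cycle u v u<v uv cu≡cv (isOn⇒zero _ on))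

  -- For a suitable `ω`, a `k`-colouring of `thinned ω` would have more than `n` survivors, yet at
  -- most `cycles ω` of them, which is less than `n`.
  exists-sparsification : ∀ {d} .{{_ : NonZero r}} .{{_ : NonZero k}} → 1 ≤ n → MaxDegree G d →
    (∀ l → l < r → 2 * r * d ^ suc l ≤ D ^ suc (suc l)) →
    (∀ c → y * ((2 * k + 2) * n) ≤ monoEdges c) →
    ∃[ H ] (H ⊑ G × (∀ ℓ → HasCycle H ℓ → r ≤ ℓ) × ¬ Colourable H k)
  exists-sparsification 1≤n Δ≤d sparse many =
    thinned ω , thinned⊑ ω , thinned-no-short-cycle ω , λ (c , proper) →
      <-irrefl refl (begin-strict
        n              <⟨ n<survivors (tabulate c) ⟩
        survivors (lookup (tabulate c)) ω
          ≤⟨ survivors≤cycles ω (lookup (tabulate c)) (λ u v uv eq → proper u v uv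
               (trans (sym (lookup∘tabulate c u)) (trans eq (lookup∘tabulate c v)))) ⟩
        cycles ω       <⟨ cycles<n ⟩
        n              ∎)
    where
    open ≤-Reasoning

    -- One average controls both failures: the cycles contribute at most a half of `n * 2 ^ N` and
    -- the penalties at most a quarter, so some `ω` stays strictly below it.
    potential : Ω → ℕ
    potential ω = 2 ^ N * cycles ω + n * 2 ^ n * totalPenalty ω

    sum-potential : sumVec N potential < D ^ N * (n * 2 ^ N)
    sum-potential = *-cancelˡ-< 4 _ _ (begin-strict
      4 * sumVec N potential
        ≡⟨ cong (4 *_) (trans (sumVec-+ N (λ ω → 2 ^ N * cycles ω) (λ ω → n * 2 ^ n * totalPenalty ω))
             (cong₂ _+_ (sumVec-*ˡ N (2 ^ N) cycles) (sumVec-*ˡ N (n * 2 ^ n) totalPenalty))) ⟩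
      4 * (2 ^ N * sumVec N cycles + n * 2 ^ n * sumVec N totalPenalty)
        ≡⟨ split (2 ^ N) (sumVec N cycles) n (2 ^ n) (sumVec N totalPenalty) ⟩
      2 * (2 ^ N * (2 * sumVec N cycles)) + n * (4 * (2 ^ n * sumVec N totalPenalty))
        ≤⟨ +-mono-≤ (*-monoʳ-≤ 2 (*-monoʳ-≤ (2 ^ N) (sum-cycles Δ≤d sparse)))
                    (*-monoʳ-≤ n (sum-totalPenalty 1≤n many)) ⟩
      2 * (2 ^ N * (n * D ^ N)) + n * (2 ^ N * D ^ N)
        <⟨ m<m+n _ (>-nonZero⁻¹ (n * (2 ^ N * D ^ N))
             {{m*n≢0 n (2 ^ N * D ^ N) {{>-nonZero 1≤n}} {{m*n≢0 (2 ^ N) (D ^ N) {{m^n≢0 2 N}} {{m^n≢0 D N}}}}}}) ⟩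
      2 * (2 ^ N * (n * D ^ N)) + n * (2 ^ N * D ^ N) + n * (2 ^ N * D ^ N)
        ≡⟨ merge (2 ^ N) n (D ^ N) ⟩
      4 * (D ^ N * (n * 2 ^ N)) ∎)
      where
      split : ∀ t z n s a → 4 * (t * z + n * s * a) ≡ 2 * (t * (2 * z)) + n * (4 * (s * a))
      split = solve-∀
      merge : ∀ t n e → 2 * (t * (n * e)) + n * (t * e) + n * (t * e) ≡ 4 * (e * (n * t))
      merge = solve-∀

    found : ∃[ ω ] potential ω < n * 2 ^ N
    found = sumVec<⇒∃ N potential (n * 2 ^ N) sum-potential

    ω = proj₁ found

    cycles<n : cycles ω < n
    cycles<n = *-cancelˡ-< (2 ^ N) _ _ (begin-strict
      2 ^ N * cycles ω   ≤⟨ m≤m+n _ _ ⟩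
      potential ω        <⟨ proj₂ found ⟩
      n * 2 ^ N          ≡⟨ *-comm n (2 ^ N) ⟩
      2 ^ N * n          ∎)

    -- With the weight `n * 2 ^ n`, a single colouring with at most `n` survivors would already lift
    -- `potential` to `n * 2 ^ N`.
    n<survivors : ∀ f → n < survivors (lookup f) ω
    n<survivors f = ≰⇒> λ s≤n → <⇒≱ 2^n<2^s (^-monoʳ-≤ 2 s≤n)
      where
      s = survivors (lookup f) ω
      π = penalty (lookup f) ω
      regroup : ∀ n π t → n * π * t ≡ n * t * π
      regroup = solve-∀
      2^n<2^s : 2 ^ n < 2 ^ s
      2^n<2^s = *-cancelˡ-< (n * π) _ _ (begin-strict
        n * π * 2 ^ n             ≡⟨ regroup n π (2 ^ n) ⟩
        n * 2 ^ n * π             ≤⟨ *-monoʳ-≤ (n * 2 ^ n) (term≤sumVec (λ f → penalty (lookup f) ω) f) ⟩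
        n * 2 ^ n * totalPenalty ω ≤⟨ m≤n+m _ _ ⟩
        potential ω               <⟨ proj₂ found ⟩
        n * 2 ^ N                 ≡⟨ cong (n *_) (penalty*2^survivors (lookup f) ω) ⟨
        n * (π * 2 ^ s)           ≡⟨ *-assoc n π (2 ^ s) ⟨
        n * π * 2 ^ s             ∎)

-- Parameters for a regular graph

monoPairs≤2*monoEdges : ∀ G {b r k} (c : V G → Fin k) →
  monoPairs G c ≤ 2 * Sparsification.monoEdges G b r k c
monoPairs≤2*monoEdges G c = sum-symmetric (λ u v → adj? u v ×-dec c u ≟ᶠ c v)
  (λ (uv , eq) → adj-sym uv , sym eq) (irrefl ∘ proj₁)
  where open Graph G hiding (V)

uncolourable⇒nonempty : ∀ G {t} → ¬ Colourable G t → 1 ≤ Graph.order G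
uncolourable⇒nonempty G ¬col with 1 ≤? Graph.order G
... | yes 1≤n = 1≤n
... | no  1≰n = contradiction ((λ v → contradiction v no-vertex) , λ v → contradiction v no-vertex) ¬col
  where
  no-vertex : ¬ V G
  no-vertex v = 1≰n (≤-trans (s≤s z≤n) (Finₚ.toℕ<n v))

-- With `D` the integer part of d / B, regularity yields at least `2 * D * L * n` monochromatic
-- edges for every colouring, while `d ≤ 2 * B * D` reduces `sparse` to `2 * r * (2 * B) ^ r ≤ D`.
sparsify-regular : ∀ {r k q d} .{{_ : NonZero r}} .{{_ : NonZero k}} .{{_ : NonZero q}} →
  2 * r ≤ q → 8 * (2 * k + 2) ≤ q → ∀ G → MaxDegree G d →
  ¬ Colourable G (q ^ suc (3 * suc r)) → Regular G k q d →
  ∃[ H ] (H ⊑ G × (∀ ℓ → HasCycle H ℓ → r ≤ ℓ) × ¬ Colourable H k)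
sparsify-regular {r} {k} {q} {d} 2r≤q 8L≤q G Δ≤d ¬col regular =
  exists-sparsification (uncolourable⇒nonempty G ¬col) Δ≤d sparse many
  where
  open ≤-Reasoning
  L B n : ℕ
  L = 2 * k + 2
  -- One factor two accounts for ordered pairs against edges, the other for `suc (b * 2) < 2 * D`.
  B = 4 * L * (q * q)
  n = Graph.order G

  instance
    L≢0 : NonZero L
    L≢0 = >-nonZero (≤-trans (s≤s z≤n) (m≤n+m 2 (2 * k)))
    q²≢0 : NonZero (q * q)
    q²≢0 = m*n≢0 q q
    B≢0 : NonZero B
    B≢0 = m*n≢0 (4 * L) (q * q) {{m*n≢0 4 L}}
    2B≢0 : NonZero (2 * B)
    2B≢0 = m*n≢0 2 B

  -- The chromatic hypothesis enters as `q ^ suc (3 * suc r) ≤ d`: one `q` pays for `2 * r`, and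
  -- each of `suc r` factors `q ^ 3` for a `2 * B`, the last of them covering the division by `B`.
  2r[2B]^r≤d/B : 2 * r * (2 * B) ^ r ≤ d / B
  2r[2B]^r≤d/B = begin
    2 * r * (2 * B) ^ r          ≡⟨ m*n/n≡m (2 * r * (2 * B) ^ r) B ⟨
    2 * r * (2 * B) ^ r * B / B  ≤⟨ /-monoˡ-≤ B (begin
      2 * r * (2 * B) ^ r * B          ≤⟨ *-monoʳ-≤ (2 * r * (2 * B) ^ r) (m≤n*m B 2) ⟩
      2 * r * (2 * B) ^ r * (2 * B)    ≡⟨ *-assoc (2 * r) ((2 * B) ^ r) (2 * B) ⟩
      2 * r * ((2 * B) ^ r * (2 * B))  ≡⟨ cong (2 * r *_) (*-comm ((2 * B) ^ r) (2 * B)) ⟩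
      2 * r * (2 * B) ^ suc r          ≤⟨ *-mono-≤ 2r≤q (^-monoˡ-≤ (suc r) 2B≤q³) ⟩
      q * (q ^ 3) ^ suc r              ≡⟨ cong (q *_) (^-*-assoc q 3 (suc r)) ⟩
      q ^ suc (3 * suc r)              ≤⟨ uncolourable⇒≤maxDegree G Δ≤d ¬col ⟩
      d                                ∎) ⟩
    d / B                        ∎
    where
    2B≤q³ : 2 * B ≤ q ^ 3
    2B≤q³ = begin
      2 * (4 * L * (q * q))   ≡⟨ regroup L q ⟩
      8 * L * (q * (q * 1))   ≤⟨ *-monoˡ-≤ (q * (q * 1)) 8L≤q ⟩
      q ^ 3                   ∎
      where
      regroup : ∀ L q → 2 * (4 * L * (q * q)) ≡ 8 * L * (q * (q * 1))
      regroup = solve-∀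

  b D : ℕ
  b = pred (d / B)
  D = suc b

  D≡d/B : D ≡ d / B
  D≡d/B = suc-pred (d / B) {{>-nonZero (≤-trans
    (>-nonZero⁻¹ (2 * r * (2 * B) ^ r)
      {{m*n≢0 (2 * r) ((2 * B) ^ r) {{m*n≢0 2 r}} {{m^n≢0 (2 * B) r}}}})
    2r[2B]^r≤d/B)}}

  open Sparsification G b r k using (exists-sparsification; monoEdges)

  D*B≤d : D * B ≤ d
  D*B≤d = ≤-trans (≤-reflexive (cong (_* B) D≡d/B)) (m/n*n≤m d B)

  d≤2B*D : d ≤ 2 * B * D
  d≤2B*D = begin
    d                    ≡⟨ m≡m%n+[m/n]*n d B ⟩
    d % B + d / B * B    ≤⟨ +-monoˡ-≤ (d / B * B) (m%n≤n d B) ⟩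
    B + d / B * B        ≡⟨ cong (λ x → B + x * B) D≡d/B ⟨
    B + D * B            ≤⟨ +-monoˡ-≤ (D * B) (m≤m*n B D) ⟩
    B * D + D * B        ≡⟨ regroup B D ⟩
    2 * B * D            ∎
    where
    regroup : ∀ B D → B * D + D * B ≡ 2 * B * D
    regroup = solve-∀

  sparse : ∀ l → l < r → 2 * r * d ^ suc l ≤ D ^ suc (suc l)
  sparse l l<r = begin
    2 * r * d ^ suc l                       ≤⟨ *-monoʳ-≤ (2 * r) (^-monoˡ-≤ (suc l) d≤2B*D) ⟩
    2 * r * (2 * B * D) ^ suc l             ≡⟨ cong (2 * r *_) (^-distribʳ-* (2 * B) D (suc l)) ⟩
    2 * r * ((2 * B) ^ suc l * D ^ suc l)   ≡⟨ *-assoc (2 * r) _ (D ^ suc l) ⟨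
    2 * r * (2 * B) ^ suc l * D ^ suc l     ≤⟨ *-monoˡ-≤ (D ^ suc l) (*-monoʳ-≤ (2 * r) (^-monoʳ-≤ (2 * B) l<r)) ⟩
    2 * r * (2 * B) ^ r * D ^ suc l         ≤⟨ *-monoˡ-≤ (D ^ suc l) 2r[2B]^r≤d/B ⟩
    d / B * D ^ suc l                       ≡⟨ cong (_* D ^ suc l) D≡d/B ⟨
    D ^ suc (suc l)                         ∎

  many : ∀ c → suc (b * 2) * (L * n) ≤ monoEdges c
  many c = *-cancelʳ-≤ _ _ (2 * (q * q)) {{m*n≢0 2 (q * q)}} (begin
    suc (b * 2) * (L * n) * (2 * (q * q))   ≤⟨ *-monoˡ-≤ (2 * (q * q)) (*-monoˡ-≤ (L * n) (n≤1+n (suc (b * 2)))) ⟩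
    D * 2 * (L * n) * (2 * (q * q))         ≡⟨ regroup D L n q ⟩
    n * (D * B)                             ≤⟨ *-monoʳ-≤ n D*B≤d ⟩
    n * d                                   ≤⟨ regular c ⟩
    monoPairs G c * (q * q)                 ≤⟨ *-monoˡ-≤ (q * q) (monoPairs≤2*monoEdges G {b} {r} c) ⟩
    2 * monoEdges c * (q * q)               ≡⟨ swap (monoEdges c) (q * q) ⟩
    monoEdges c * (2 * (q * q))             ∎)
    where
    regroup : ∀ D L n q → D * 2 * (L * n) * (2 * (q * q)) ≡ n * (D * (4 * L * (q * q)))
    regroup = solve-∀
    swap : ∀ m s → 2 * m * s ≡ m * (2 * s)
    swap = solve-∀

-- Graphs with polynomially many edges

-- Raising `m` by one raises the integer part of its `K`-th root by at most one.
integer-root : ∀ K .{{_ : NonZero K}} m → ∃[ q ] (q ^ K ≤ m × m < suc q ^ K)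
integer-root K@(suc _) zero = 0 , z≤n , m^n>0 1 K
integer-root K (suc m) with integer-root K m
... | q , q^K≤m , m<[1+q]^K with suc m <? suc q ^ K
...   | yes 1+m< = q , m≤n⇒m≤1+n q^K≤m , 1+m<
...   | no  1+m≮ = suc q , ≮⇒≥ 1+m≮ , ≤-<-trans m<[1+q]^K (^-monoˡ-< K (n<1+n (suc q)))

χ-least : ∀ G {j} → Colourable G j → χ G ≤ j
χ-least G {j} = proj₂ (proj₂ (leastColouring G)) j

-- Take `q` as the integer part of the `K`-th root of `χ G`. Then `q ^ K` is `q` times the number of
-- colours `sparsify-regular` asks for, and this spare `q` outweighs the loss `(k * 2) ^ J`.
polynomially-many-edges : ∀ r k .{{_ : NonZero r}} .{{_ : NonZero k}} a →
  ∃[ M ] (∀ (G : Graph) → M ≤ χ G → (2 * e G) * (2 * e G) ≤ χ G ^ a →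
    ∃[ H ] (H ⊑ G × (∀ ℓ → HasCycle H ℓ → r ≤ ℓ) × ¬ Colourable H k))
polynomially-many-edges r k a = suc Q₀ ^ K , λ G M≤χ e≤ → from-root G M≤χ e≤ (integer-root K (χ G))
  where
  K J Q₀ : ℕ
  K  = suc (suc (3 * suc r))
  -- `χ G ^ a` is at most `suc q ^ (K * a)`, hence at most `q ^ (2 * (K * a))`; the `suc` makes the
  -- bound strict. As `J` does not depend on `q`, `Q₀` is a constant.
  J  = suc (2 * (K * a))
  Q₀ = 2 + (k * 2) ^ J + (2 * r + 8 * (2 * k + 2))

  from-root : ∀ G → suc Q₀ ^ K ≤ χ G → (2 * e G) * (2 * e G) ≤ χ G ^ a →
    ∃[ q ] (q ^ K ≤ χ G × χ G < suc q ^ K) →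
    ∃[ H ] (H ⊑ G × (∀ ℓ → HasCycle H ℓ → r ≤ ℓ) × ¬ Colourable H k)
  from-root G M≤χ e≤ (q , q^K≤χ , χ<[1+q]^K) =
    let G₁ , d₁ , G₁⊑G , Δ₁ , ¬col₁ , nd₁ = drop-isolated G ¬col
        G₂ , d₂ , G₂⊑G₁ , Δ₂ , ¬col₂ , regular = regularise {k} {q} {t = t} J G₁ Δ₁ ¬col₁ (≤-<-trans (≤-trans nd₁ e≤) χ^a<q^J)
        H , H⊑G₂ , rest = sparsify-regular {r} {k} {q} 2r≤q 8L≤q G₂ Δ₂ ¬col₂ regular
    in H , ⊑-trans {H} {G₂} {G} H⊑G₂ (⊑-trans {G₂} {G₁} {G} G₂⊑G₁ G₁⊑G) , rest
    where
    open ≤-Reasoning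
    t = q ^ suc (3 * suc r)

    Q₀≤q : Q₀ ≤ q
    Q₀≤q = ≮⇒≥ λ q<Q₀ → <-irrefl refl (begin-strict
      suc Q₀ ^ K  ≤⟨ M≤χ ⟩
      χ G         <⟨ χ<[1+q]^K ⟩
      suc q ^ K   ≤⟨ ^-monoˡ-≤ K (≤-trans q<Q₀ (n≤1+n Q₀)) ⟩
      suc Q₀ ^ K  ∎)

    2+[2k]^J≤q : 2 + (k * 2) ^ J ≤ q
    2+[2k]^J≤q = ≤-trans (m≤m+n _ _) Q₀≤q

    2≤q : 2 ≤ q
    2≤q = ≤-trans (m≤m+n 2 ((k * 2) ^ J)) 2+[2k]^J≤q

    2r+8L≤q : 2 * r + 8 * (2 * k + 2) ≤ q
    2r+8L≤q = ≤-trans (m≤n+m _ (2 + (k * 2) ^ J)) Q₀≤q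

    2r≤q : 2 * r ≤ q
    2r≤q = ≤-trans (m≤m+n _ _) 2r+8L≤q

    8L≤q : 8 * (2 * k + 2) ≤ q
    8L≤q = ≤-trans (m≤n+m _ (2 * r)) 2r+8L≤q

    instance
      q≢0 : NonZero q
      q≢0 = >-nonZero (≤-trans (s≤s z≤n) 2≤q)
      t≢0 : NonZero t
      t≢0 = m^n≢0 q (suc (3 * suc r))
      col≢0 : NonZero ((k * 2) ^ J * t)
      col≢0 = m*n≢0 ((k * 2) ^ J) t {{m^n≢0 (k * 2) J {{m*n≢0 k 2}}}}

    ¬col : ¬ Colourable G ((k * 2) ^ J * t)
    ¬col col = <-irrefl refl (begin-strict
      (k * 2) ^ J * t  <⟨ *-monoˡ-< t (≤-trans (n≤1+n _) 2+[2k]^J≤q) ⟩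
      q * t            ≤⟨ q^K≤χ ⟩
      χ G              ≤⟨ χ-least G col ⟩
      (k * 2) ^ J * t  ∎)

    χ^a<q^J : χ G ^ a < q ^ J
    χ^a<q^J = begin-strict
      χ G ^ a             ≤⟨ ^-monoˡ-≤ a (<⇒≤ χ<[1+q]^K) ⟩
      (suc q ^ K) ^ a     ≡⟨ ^-*-assoc (suc q) K a ⟩
      suc q ^ (K * a)     ≤⟨ ^-monoˡ-≤ (K * a) 1+q≤q² ⟩
      (q ^ 2) ^ (K * a)   ≡⟨ ^-*-assoc q 2 (K * a) ⟩
      q ^ (2 * (K * a))   <⟨ ^-monoʳ-< q 2≤q (n<1+n (2 * (K * a))) ⟩
      q ^ J               ∎
      where
      1+q≤q² : suc q ≤ q ^ 2
      1+q≤q² = begin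
        1 + q          ≤⟨ +-monoˡ-≤ q (≤-trans (s≤s z≤n) 2≤q) ⟩
        q + q          ≡⟨ double q ⟩
        2 * (q * 1)    ≤⟨ *-monoˡ-≤ (q * 1) 2≤q ⟩
        q ^ 2          ∎
        where
        double : ∀ q → q + q ≡ 2 * (q * 1)
        double = solve-∀

-- From real to natural bounds

ℕ→ℚ≡mkℚ : ∀ n → ℕ→ℚ n ≡ mkℚ (ℤ.+ n) 0 (coprime-sym (1-coprimeTo n))
ℕ→ℚ≡mkℚ n = ℚₚ.normalize-coprime (coprime-sym (1-coprimeTo n))

ℕ→ℚ-* : ∀ m n → ℕ→ℚ m ℚ.* ℕ→ℚ n ≡ ℕ→ℚ (m * n)
ℕ→ℚ-* m n = trans (cong₂ ℚ._*_ (ℕ→ℚ≡mkℚ m) (ℕ→ℚ≡mkℚ n)) (cong (ℚ._/ 1) (sym (ℤₚ.pos-* m n)))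

ℕ→ℚ-mono-< : ∀ {m n} → m < n → ℕ→ℚ m ℚ.< ℕ→ℚ n
ℕ→ℚ-mono-< {m} {n} m<n = subst₂ ℚ._<_ (sym (ℕ→ℚ≡mkℚ m)) (sym (ℕ→ℚ≡mkℚ n))
  (*<* (subst₂ ℤ._<_ (sym (ℤₚ.*-identityʳ (ℤ.+ m))) (sym (ℤₚ.*-identityʳ (ℤ.+ n))) (ℤ.+<+ m<n)))

ℕ→ℚ-cancel-< : ∀ {m n} → ℕ→ℚ m ℚ.< ℕ→ℚ n → m < n
ℕ→ℚ-cancel-< {m} {n} m<n = ℤₚ.drop‿+<+ (subst₂ ℤ._<_ (ℤₚ.*-identityʳ (ℤ.+ m)) (ℤₚ.*-identityʳ (ℤ.+ n))
  (ℚₚ.drop-*<* (subst₂ ℚ._<_ (ℕ→ℚ≡mkℚ m) (ℕ→ℚ≡mkℚ n) m<n)))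

-- Naturals above `P` and `C` are read off the cuts, and the hypothesis is evaluated at the
-- successor of a product of upper bounds for the two real factors. Successors inside that product
-- make its factors positive and the inequalities strict.
natural-bound : ∀ P C → ∃[ p ] ∃[ c ] (∀ m x → ℕ→ℝ m ≤ℝ C *ℝ (x ^ℝ P) → m ≤ c * suc (x ^ p))
natural-bound P C = p , suc c , λ m x m≤CxP → ≤-pred (ℕ→ℚ-cancel-< (m≤CxP
  (ℕ→ℚ (suc c) , ℕ→ℚ (suc (x ^ p)) ,
   ℕ→ℚ-mono-< {0} {suc c} (s≤s z≤n) , upward C (ℕ→ℚ-mono-< (n<1+n c)) C<c ,
   ℕ→ℚ-mono-< {0} {suc (x ^ p)} (s≤s z≤n) ,
   -- The `0` encodes the denominator `suc 0`: the rational exponent is `p` itself.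
   (p , 0 , ℕ→ℚ (x ^ p) , P<p ,
    ℚₚ.nonNegative⁻¹ (ℕ→ℚ (x ^ p)) {{ℚₚ.normalize-nonNeg (x ^ p) 1}} ,
    ℚₚ.≤-reflexive (sym (ℚₚ.*-identityʳ (ℕ→ℚ (x ^ p)))) , ℕ→ℚ-mono-< (n<1+n (x ^ p))) ,
   subst (ℚ._< ℕ→ℚ (suc (suc c * suc (x ^ p)))) (sym (ℕ→ℚ-* (suc c) (suc (x ^ p))))
     (ℕ→ℚ-mono-< (n<1+n (suc c * suc (x ^ p)))))))
  where
  p = proj₁ (natAbove P)
  P<p = proj₂ (natAbove P)
  c = proj₁ (natAbove C)
  C<c = proj₂ (natAbove C)

-- The constant goes into one more power of `x`: `suc (x ^ p)` is at most twice `x ^ p`, and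
-- `4 * c ≤ x`.
[2m]²≤x^a : ∀ {m c x p} → 1 ≤ x → 4 * c ≤ x → m ≤ c * suc (x ^ p) →
            (2 * m) * (2 * m) ≤ x ^ (suc p * 2)
[2m]²≤x^a {m} {c} {x} {p} 1≤x 4c≤x m≤ = begin
  2 * m * (2 * m)        ≤⟨ *-mono-≤ 2m≤ 2m≤ ⟩
  x ^ suc p * x ^ suc p  ≡⟨ cong (x ^ suc p *_) (*-identityʳ (x ^ suc p)) ⟨
  (x ^ suc p) ^ 2        ≡⟨ ^-*-assoc x (suc p) 2 ⟩
  x ^ (suc p * 2)        ∎
  where
  open ≤-Reasoning
  instance _ = >-nonZero 1≤x
  2m≤ : 2 * m ≤ x ^ suc p
  2m≤ = begin
    2 * m                      ≤⟨ *-monoʳ-≤ 2 m≤ ⟩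
    2 * (c * suc (x ^ p))      ≤⟨ *-monoʳ-≤ 2 (*-monoʳ-≤ c (+-monoˡ-≤ (x ^ p) (m^n>0 x p))) ⟩
    2 * (c * (x ^ p + x ^ p))  ≡⟨ regroup c (x ^ p) ⟩
    4 * c * x ^ p              ≤⟨ *-monoˡ-≤ (x ^ p) 4c≤x ⟩
    x ^ suc p                  ∎
    where
    regroup : ∀ c s → 2 * (c * (s + s)) ≡ 4 * c * s
    regroup = solve-∀

-- Girth, chromatic number and conclusion

no-short-cycle⇒≤girth : ∀ H {r} → (∀ ℓ → HasCycle H ℓ → r ≤ ℓ) → [ r ] ≤⁺ girth H
no-short-cycle⇒≤girth H long with girth H | proj₂ (girthExists H)
... | _ | shortest (cycle , _) = AddSup.[ long _ cycle ]
... | _ | forest _             = [ _ ] AddSup.≤⊤⁺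

uncolourable⇒≤χ : ∀ H {k} → ¬ Colourable H k → k ≤ χ H
uncolourable⇒≤χ H ¬col = ≮⇒≥ λ χ<k →
  ¬col (colourable-mono H (<⇒≤ χ<k) (proj₁ (proj₂ (leastColouring H))))

theorem1p1 : ∀ (r k : ℕ) → 4 ≤ r → 2 ≤ k →
    ∀ (P C : ℝ) → Positiveℝ P → Positiveℝ C →
    ∃[ M ] (∀ (G : Graph) → M ≤ χ G → ℕ→ℝ (e G) ≤ℝ C *ℝ (χ G ^ℝ P) →
    ∃[ H ] (H ⊑ G × [ r ] ≤⁺ girth H × k ≤ χ H))
theorem1p1 r@(suc _) k@(suc _) _ _ P C _ _ =
  let p , c , bound = natural-bound P C
      M , large = polynomially-many-edges r k (suc p * 2)
  -- The summand `1 + 4 * c` makes `χ G` large enough to absorb the constant from `natural-bound`.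
  in 1 + 4 * c + M , λ G M≤χ e≤ →
    let 1+4c≤χ = ≤-trans (m≤m+n (1 + 4 * c) M) M≤χ
        H , H⊑G , long , ¬col = large G (≤-trans (m≤n+m M (1 + 4 * c)) M≤χ)
          ([2m]²≤x^a {e G} {c} {χ G} {p} (≤-trans (s≤s z≤n) 1+4c≤χ) (≤-trans (n≤1+n (4 * c)) 1+4c≤χ) (bound (e G) (χ G) e≤))
    in H , H⊑G , no-short-cycle⇒≤girth H long , uncolourable⇒≤χ H ¬col
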